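{- Let $k$ be such that $2k$ is a positive integer, and let $n\ge 0$. (1) For every $k$-Eulerian poset $P$ of rank $n+1$, every subset $S\subseteq[1,n]$, and every maximal interval $[i,\ell]$ (set of consecutive integers, maximal under inclusion) of $[1,n]\setminus S$, $$k\bigl((-1)^{i-1}+(-1)^{\ell+1}\bigr)f_S(P)+\sum_{j=i}^{\ell}(-1)^j f_{S\cup\{j\}}(P)=0.$$ (2) Every linear equality $\sum_{S\subseteq[1,n]}c_Sf_S(P)=0$ holding for the flag vectors of all $k$-Eulerian posets $P$ of rank $n+1$ is a linear consequence of the equations in (1). (3) As linear conditions on $(f_S)_{S\subseteq[1,n]}$, the equations in (1) are equivalent to the set of equations $L^{k,n+1}_S=0$ for all subsets $S\subseteq[1,n]$ that are not even.
   Context: A graded poset is a finite poset with unique minimum $\hat 0$, unique maximum $\hat 1$, and a rank function $\rho$ with $\rho(\hat0)=0$ and $\rho(y)-\rho(x)=1$ when $y$ covers $x$; its rank is $\rho(\hat1)$, $\rho(x,y)=\rho(y)-\rho(x)$. For $P$ of rank $n+1$ and $S\subseteq[1,n]$, $f_S(P)$ is the number of chains in $P$ whose set of ranks is exactly $S$ ($f_\emptyset=1$). The $k$-Möbius function: $\mu_k([x,x])=1$ and, for $x<y$, $\mu_k([x,y])=-1-\frac1k\sum_{x<z<y}\mu_k([x,z])$; $P$ is $k$-Eulerian if $\mu_k([x,y])=(-1)^{\rho(x,y)}$ for all intervals. The flag $L^k$-vector is $L^{k,n+1}_S=(-1)^{n-|S|}\sum_{T\supseteq[1,n]\setminus S}\left(-\frac1{2k}\right)^{|T|}f_T$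 for $S\subseteq[1,n]$ (sum over $T\subseteq[1,n]$). A set $S\subseteq[1,n]$ is even if it is a disjoint union of intervals of consecutive integers each of even cardinality (equivalently, each maximal run of consecutive integers in $S$ has even length). -}

module Defs where

open import Data.Bool.Base using (Bool; true; false; _∧_; not; if_then_else_)
open import Data.Nat.Base using (ℕ; zero; suc; _∸_; _≤_; _≡ᵇ_) renaming (_+_ to _+ℕ_)
open import Data.Nat.Divisibility using (_∣_)
open import Data.Fin.Base using (Fin)
open import Data.Fin.Properties using (_≟_)
open import Data.Fin.Subset using (Subset; ∣_∣)
open import Data.Vec.Base using (Vec; []; _∷_)
open import Data.List.Base using (List; []; _∷_; map; foldr; _++_; upTo; allFin)
open import Data.Integer.Base using (+_)
open import Data.Rational.Base using (ℚ; 0ℚ; 1ℚ; _+_; _*_; -_; _/_)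
open import Data.Product.Base using (_×_; Σ; proj₁; proj₂)
open import Data.Sum.Base using (_⊎_)
open import Relation.Nullary.Decidable.Core using (yes; no; ⌊_⌋)
open import Relation.Binary.PropositionalEquality using (_≡_)

record GradedPoset : Set where
  field
    size    : ℕ
    leq     : Fin size → Fin size → Bool
    leq-refl    : ∀ x → leq x x ≡ true
    leq-antisym : ∀ x y → leq x y ≡ true → leq y x ≡ true → x ≡ y
    leq-trans   : ∀ x y z → leq x y ≡ true → leq y z ≡ true → leq x z ≡ true
    bot     : Fin size
    top     : Fin size
    bot-min : ∀ x → leq bot x ≡ true
    top-max : ∀ x → leq x top ≡ true
    rank    : Fin size → ℕ
    rank-bot : rank bot ≡ 0
    rank-cover : ∀ x y →
      (leq x y ∧ not ⌊ x ≟ y ⌋) ≡ true →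
      (∀ z → (leq x z ∧ not ⌊ x ≟ z ⌋ ∧ leq z y ∧ not ⌊ z ≟ y ⌋) ≡ false) →
      rank y ≡ suc (rank x)

  lt : Fin size → Fin size → Bool
  lt x y = leq x y ∧ not ⌊ x ≟ y ⌋

open GradedPoset public

rankP : GradedPoset → ℕ
rankP P = rank P (top P)

sumℚ : List ℚ → ℚ
sumℚ = foldr _+_ 0ℚ

sumℕ : List ℕ → ℕ
sumℕ = foldr _+ℕ_ 0

neg1^ : ℕ → ℚ
neg1^ zero    = 1ℚ
neg1^ (suc j) = - neg1^ j

powℚ : ℚ → ℕ → ℚ
powℚ q zero    = 1ℚ
powℚ q (suc m) = q * powℚ q m

fromℕℚ : ℕ → ℚ
fromℕℚ m = + m / 1

-- The parameter k is encoded by t : ℕ with 2k = t + 1 (so 2k ranges over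
-- all positive integers).
kval : ℕ → ℚ
kval t = + (suc t) / 2

kinv : ℕ → ℚ
kinv t = + 2 / suc t

negInv2k : ℕ → ℚ
negInv2k t = - (+ 1 / suc t)

-- k-Möbius function.  mu fuel x y: the recursion
--   μ_k([x,x]) = 1,  μ_k([x,y]) = -1 - (1/k) Σ_{x<z<y} μ_k([x,z])  (x<y)
-- computed with a fuel parameter; fuel ≥ ρ(x,y) suffices, and we use
-- fuel = size P, which always suffices (ρ(x,y) < size P).

muF : ℕ → (P : GradedPoset) → ℕ → Fin (size P) → Fin (size P) → ℚ
muF t P fuel x y with x ≟ y
... | yes _ = 1ℚ
... | no _ with leq P x y | fuel
...   | false | _      = 0ℚ
...   | true  | zero   = 0ℚ
...   | true  | suc d  =
        - 1ℚ + - (kinv t * sumℚ (map (λ z → if lt P x z ∧ lt P z y then muF t P d x z else 0ℚ)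
                                     (allFin (size P))))

muK : ℕ → (P : GradedPoset) → Fin (size P) → Fin (size P) → ℚ
muK t P = muF t P (size P)

KEulerian : ℕ → GradedPoset → Set
KEulerian t P = ∀ x y → leq P x y ≡ true →
  muK t P x y ≡ neg1^ (rank P y ∸ rank P x)

-- Subsets of [1,n] are Subset n = Vec Bool n; position p (0-based)
-- stands for the integer p+1.

-- membership of an integer j in S ⊆ [1,n] (false if j ∉ [1,n])
inS : ∀ {n} → Subset n → ℕ → Bool
inS []      _             = false
inS (b ∷ S) zero          = false
inS (b ∷ S) (suc zero)    = b
inS (b ∷ S) (suc (suc j)) = inS S (suc j)

insS : ∀ {n} → Subset n → ℕ → Subset n
insS []      _             = []
insS (b ∷ S) zero          = b ∷ S
insS (b ∷ S) (suc zero)    = true ∷ S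
insS (b ∷ S) (suc (suc j)) = b ∷ insS S (suc j)

ranksFrom : ∀ {n} → ℕ → Subset n → List ℕ
ranksFrom o []          = []
ranksFrom o (true ∷ S)  = o ∷ ranksFrom (suc o) S
ranksFrom o (false ∷ S) = ranksFrom (suc o) S

elems : ∀ {n} → Subset n → List ℕ
elems = ranksFrom 1

allSubsets : (n : ℕ) → List (Subset n)
allSubsets zero    = [] ∷ []
allSubsets (suc n) = map (false ∷_) (allSubsets n) ++ map (true ∷_) (allSubsets n)

range : ℕ → ℕ → List ℕ
range i ℓ = map (i +ℕ_) (upTo (suc ℓ ∸ i))

-- Flag f-vector.  A chain whose rank set is exactly S = {s₁<…<s_m} is
-- the same as a strictly increasing sequence x₁<…<x_m with ρ(x_a)=s_a
-- (ranks strictly increase along a chain).  chainsAbove x rs counts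
-- sequences x < x₁ < … < x_m with ranks rs.

chainsAbove : (P : GradedPoset) → Fin (size P) → List ℕ → ℕ
chainsAbove P x []       = 1
chainsAbove P x (r ∷ rs) =
  sumℕ (map (λ y → if lt P x y ∧ (rank P y ≡ᵇ r) then chainsAbove P y rs else 0)
            (allFin (size P)))

-- f_S(P)  (elements of S are ≥ 1, so x₁ > 0̂ is automatic)
flagF : (P : GradedPoset) → ∀ {n} → Subset n → ℕ
flagF P S = chainsAbove P (bot P) (elems S)

flagVec : (P : GradedPoset) → (n : ℕ) → Subset n → ℚ
flagVec P n S = fromℕℚ (flagF P S)

MaxRun : ∀ {n} → Bool → Subset n → ℕ → ℕ → Set
MaxRun {n} b S i ℓ =
  1 ≤ i × i ≤ ℓ × ℓ ≤ n ×
  (∀ j → i ≤ j → j ≤ ℓ → inS S j ≡ b) ×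
  (i ≡ 1 ⊎ inS S (i ∸ 1) ≡ not b) ×
  (ℓ ≡ n ⊎ inS S (suc ℓ) ≡ not b)

IsEven : ∀ {n} → Subset n → Set
IsEven S = ∀ i ℓ → MaxRun true S i ℓ → 2 ∣ (suc ℓ ∸ i)

eq1 : ℕ → ∀ {n} → Subset n → ℕ → ℕ → (Subset n → ℚ) → ℚ
eq1 t S i ℓ f =
  kval t * (neg1^ (i ∸ 1) + neg1^ (suc ℓ)) * f S
  + sumℚ (map (λ j → neg1^ j * f (insS S j)) (range i ℓ))

record Eq1Index (n : ℕ) : Set where
  constructor eqIx
  field
    S   : Subset n
    i   : ℕ
    ℓ   : ℕ
    max : MaxRun false S i ℓ

applyEq1 : ℕ → ∀ {n} → Eq1Index n → (Subset n → ℚ) → ℚ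
applyEq1 t (eqIx S i ℓ _) f = eq1 t S i ℓ f

dot : ∀ {n} → (Subset n → ℚ) → (Subset n → ℚ) → ℚ
dot {n} c f = sumℚ (map (λ S → c S * f S) (allSubsets n))

InSpanEq1 : ℕ → (n : ℕ) → (Subset n → ℚ) → Set
InSpanEq1 t n c = Σ (List (ℚ × Eq1Index n)) λ combo →
  ∀ (f : Subset n → ℚ) →
    dot c f ≡ sumℚ (map (λ p → proj₁ p * applyEq1 t (proj₂ p) f) combo)

supCompl : ∀ {n} → Subset n → Subset n → Bool
supCompl []      []      = true
supCompl (s ∷ S) (u ∷ T) = (if s then true else u) ∧ supCompl S T

Lk : ℕ → (n : ℕ) → Subset n → (Subset n → ℚ) → ℚ
Lk t n S f = neg1^ (n ∸ ∣ S ∣) *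
  sumℚ (map (λ T → if supCompl S T then powℚ (negInv2k t) ∣ T ∣ * f T else 0ℚ)
            (allSubsets n))

{-# OPTIONS --safe #-}

-- If μ_k = (-1)^ρ, its recursion says Σ_{x<z<y} (-1)^ρ(z) = -k((-1)^ρ(x) + (-1)^ρ(y)),
-- and summing this over all chains with rank set S, for the interval [x,y] that
-- spans a gap of S, gives the relations.
--
-- Read subsets from left to right. In a gap of length m, expressing f through
-- the sums of q^|T| f_T, q = -1/(2k), over supersets turns the relation for the
-- gap into one whose coefficient at a subset B of the gap is, up to sign,
-- Σ_{j∈B} (-1)^j + [m odd], positions being counted from the start of the gap.
-- It vanishes if B leaves only even gaps, and not if B = ∅ and m is odd: the
-- relations say exactly that L_S = 0 for S not even.
--
-- For completeness, apply this to the generic family S ↦ (f ↦ f_S) of functionals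
-- modulo the span of the relations. The ordinal sums of antichains of 2k elements
-- and of disjoint unions of two ordinal sums of two such antichains are
-- k-Eulerian, and f_S is multiplicative over the blocks; so a linear equality
-- holding for them can be reduced, rank by rank, to zero in the quotient.

module Submission where

open import Defs
open import Data.Bool.Base using (Bool; true; false; not; _∧_; _∨_; _xor_; if_then_else_)
open import Data.Bool.Properties using (T-≡; not-involutive) renaming (_≟_ to _≟ᵇ_)
open import Data.Empty using (⊥; ⊥-elim)
open import Data.Fin.Base using (Fin; zero; suc)
open import Data.Fin.Properties using (_≟_; any?)
open import Data.Fin.Subset using (Subset; ∣_∣; _∈_)
open import Data.Fin.Subset.Properties using (p⊂q⇒∣p∣<∣q∣; ∣p∣≤n)
open import Data.Integer.Base as ℤ using (ℤ) renaming (+_ to pos)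
import Data.Integer.Properties as ℤ
import Data.Integer.Tactic.RingSolver as ℤ-solver
open import Data.List.Base as List using (List; []; _∷_; map; _++_; applyUpTo; upTo; allFin; length; lookup; replicate)
import Data.List.Membership.Propositional as List
open import Data.List.Membership.Propositional.Properties using (∈-++⁺ʳ; ∈-map⁺; ∈-lookup)
open import Data.List.Properties using (map-upTo; map-applyUpTo; map-tabulate; tabulate-lookup; map-∘)
import Data.List.Relation.Unary.All as All
import Data.List.Relation.Unary.All.Properties as All
open import Data.List.Relation.Unary.Any using (here; there; index)
open import Data.List.Relation.Unary.Any.Properties using (lookup-index)
open import Data.Nat.Base using (ℕ; zero; suc; _≤_; _<_; _∸_; z≤n; s≤s; _≡ᵇ_; _≤ᵇ_) renaming (_+_ to _+ℕ_; _*_ to _*ℕ_)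
open import Data.Nat.Divisibility using (_∣_; divides)
import Data.Nat.Properties as ℕ
open import Data.Product.Base using (_×_; _,_; proj₁; proj₂; ∃-syntax)
open import Data.Rational.Base using (ℚ; 0ℚ; 1ℚ; ½; _+_; _*_; -_; _/_; toℚᵘ)
open import Data.Rational.Properties as ℚ using (+-inverseʳ; +-identityʳ; +-identityˡ; +-assoc; *-zeroˡ; *-zeroʳ; *-identityˡ; *-identityʳ; *-assoc; *-comm; *-distribʳ-+; neg-distribˡ-*; toℚᵘ-injective; toℚᵘ-homo-+; toℚᵘ-homo-*; toℚᵘ-fromℚᵘ)
open import Data.Rational.Unnormalised.Base using (mkℚᵘ; *≡*) renaming (_+_ to _+ᵘ_; _*_ to _*ᵘ_)
import Data.Rational.Unnormalised.Properties as ℚᵘ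
open import Data.Sum.Base using (_⊎_; inj₁; inj₂)
open import Data.Unit.Base using (⊤; tt)
open import Data.Vec.Base using ([]; _∷_; tabulate)
open import Data.Vec.Properties using (lookup∘tabulate; lookup⇒[]=; []=⇒lookup)
open import Function.Base using (_∘_)
open import Function.Bundles using (_⇔_; mk⇔; Equivalence)
open import Level using (0ℓ)
open import Relation.Binary.Definitions using (Tri; tri<; tri≈; tri>)
open import Relation.Binary.PropositionalEquality using (_≡_; refl; sym; trans; cong; cong₂; subst; module ≡-Reasoning)
open import Relation.Nullary.Decidable.Core using (Dec; yes; no; ⌊_⌋; dec⇒maybe)
open import Relation.Nullary.Negation.Core using (¬_)
open import Tactic.RingSolver using (solve-∀)
open import Tactic.RingSolver.Core.AlmostCommutativeRing using (AlmostCommutativeRing; fromCommutativeRing)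

-- No dimension is counted, although a count explains the choice of test posets. Even sets
-- correspond to tilings of [1,n]: a domino for two consecutive elements, a single cell for a
-- non-element. Words in `single` and `double` blocks are the same tilings, so there are exactly as
-- many test posets as sets S whose L_S stays free.
--
-- The obstacle is that the relations are indexed by a set together with a maximal gap given by its
-- end points, whereas chains, sums over subsets and parities all recurse on the first bit. Hence
-- three reformulations by recursion on bits: `Run` for gaps, `Eqs` for the relations (its state is
-- the sign and the partial alternating sum of the open gap), and `EvenNull` with `OddNull`, a
-- two-state automaton, for the conditions on L_S.
--
-- The linear algebra is done once, modulo a subspace `V` of functions on a type `X`. On a one-point
-- type with `V` the zero space it speaks of numbers, which gives the first and third claims. On
-- functionals with `V` the span of the relations, vanishing becomes membership in the span, and the
-- same lemmas produce the explicit combination that the second claim asks for.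

private variable
  A B A′ : Set
  n m i ℓ : ℕ
  b fr x : Bool
  S : Subset n

-- Arithmetic of the constants built from `t`

ℚ-ring : AlmostCommutativeRing 0ℓ 0ℓ
ℚ-ring = fromCommutativeRing ℚ.+-*-commutativeRing (λ x → dec⇒maybe (0ℚ ℚ.≟ x))

-- `_/_` reduces to lowest terms and does not compute on variables, so the identity is checked on
-- unnormalised fractions.
/-+ : ∀ a b c → (a / suc c) + (b / suc c) ≡ (a ℤ.+ b) / suc c
/-+ a b c = toℚᵘ-injective (begin
  toℚᵘ ((a / suc c) + (b / suc c))          ≈⟨ toℚᵘ-homo-+ (a / suc c) (b / suc c) ⟩
  toℚᵘ (a / suc c) +ᵘ toℚᵘ (b / suc c)      ≈⟨ ℚᵘ.+-cong (toℚᵘ-fromℚᵘ (mkℚᵘ a c)) (toℚᵘ-fromℚᵘ (mkℚᵘ b c)) ⟩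
  mkℚᵘ a c +ᵘ mkℚᵘ b c                      ≈⟨ *≡* (common a b (pos (suc c))) ⟩
  mkℚᵘ (a ℤ.+ b) c                          ≈⟨ ℚᵘ.≃-sym (toℚᵘ-fromℚᵘ (mkℚᵘ (a ℤ.+ b) c)) ⟩
  toℚᵘ ((a ℤ.+ b) / suc c) ∎)
  where
  open ℚᵘ.≃-Reasoning
  common : ∀ a b c → (a ℤ.* c ℤ.+ b ℤ.* c) ℤ.* c ≡ (a ℤ.+ b) ℤ.* (c ℤ.* c)
  common = ℤ-solver.solve-∀

/-* : ∀ a b c d → a ℤ.* b ≡ pos (suc c) ℤ.* pos (suc d) → (a / suc c) * (b / suc d) ≡ 1ℚ
/-* a b c d e = toℚᵘ-injective (begin
  toℚᵘ ((a / suc c) * (b / suc d))          ≈⟨ toℚᵘ-homo-* (a / suc c) (b / suc d) ⟩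
  toℚᵘ (a / suc c) *ᵘ toℚᵘ (b / suc d)      ≈⟨ ℚᵘ.*-cong (toℚᵘ-fromℚᵘ (mkℚᵘ a c)) (toℚᵘ-fromℚᵘ (mkℚᵘ b d)) ⟩
  mkℚᵘ a c *ᵘ mkℚᵘ b d                      ≈⟨ *≡* (trans (ℤ.*-identityʳ (a ℤ.* b)) (trans e (sym (ℤ.*-identityˡ _)))) ⟩
  mkℚᵘ (pos 1) 0 ∎)
  where open ℚᵘ.≃-Reasoning

fromℕℚ-+ : ∀ a b → fromℕℚ (a +ℕ b) ≡ fromℕℚ a + fromℕℚ b
fromℕℚ-+ a b = sym (/-+ (pos a) (pos b) 0)

kinv*kval : ∀ t → kinv t * kval t ≡ 1ℚ
kinv*kval t = /-* (pos 2) (pos (suc t)) t 1 (ℤ.*-comm (pos 2) (pos (suc t)))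

2kval : ∀ t → kval t + kval t ≡ fromℕℚ (suc t)
2kval t = trans (/-+ (pos (suc t)) (pos (suc t)) 1) (toℚᵘ-injective (begin
  toℚᵘ ((pos (suc t) ℤ.+ pos (suc t)) / 2)   ≈⟨ toℚᵘ-fromℚᵘ (mkℚᵘ (pos (suc t) ℤ.+ pos (suc t)) 1) ⟩
  mkℚᵘ (pos (suc t) ℤ.+ pos (suc t)) 1       ≈⟨ *≡* (double (pos (suc t))) ⟩
  mkℚᵘ (pos (suc t)) 0                   ≈⟨ ℚᵘ.≃-sym (toℚᵘ-fromℚᵘ (mkℚᵘ (pos (suc t)) 0)) ⟩
  toℚᵘ (fromℕℚ (suc t)) ∎))
  where
  open ℚᵘ.≃-Reasoning
  double : ∀ a → (a ℤ.+ a) ℤ.* pos 1 ≡ a ℤ.* pos 2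
  double = ℤ-solver.solve-∀

-- The only link between q = -1/(2k) and k that the linear algebra uses. It is stated as a vanishing
-- expression so that multiples of it can be removed by `drop-null`.
negInv2k*2kval : ∀ t → negInv2k t * (kval t + kval t) + 1ℚ ≡ 0ℚ
negInv2k*2kval t = begin
  - (pos 1 / suc t) * (kval t + kval t) + 1ℚ  ≡⟨ cong (λ N → negInv2k t * N + 1ℚ) (2kval t) ⟩
  - (pos 1 / suc t) * (pos (suc t) / 1) + 1ℚ      ≡⟨ cong (_+ 1ℚ) (sym (neg-distribˡ-* (pos 1 / suc t) (pos (suc t) / 1))) ⟩
  - ((pos 1 / suc t) * (pos (suc t) / 1)) + 1ℚ    ≡⟨ cong (λ u → - u + 1ℚ) (/-* (pos 1) (pos (suc t)) t 0 (ℤ.*-comm (pos 1) (pos (suc t)))) ⟩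
  0ℚ ∎
  where open ≡-Reasoning

-- Finite sums over lists

Sum : List A → (A → ℚ) → ℚ
Sum xs g = sumℚ (map g xs)

Sum-cong : ∀ (xs : List A) {g h : A → ℚ} → (∀ x → g x ≡ h x) → Sum xs g ≡ Sum xs h
Sum-cong []       e = refl
Sum-cong (x ∷ xs) e = cong₂ _+_ (e x) (Sum-cong xs e)

Sum-zero : ∀ (xs : List A) {g : A → ℚ} → (∀ x → g x ≡ 0ℚ) → Sum xs g ≡ 0ℚ
Sum-zero []       e = refl
Sum-zero (x ∷ xs) e = cong₂ _+_ (e x) (Sum-zero xs e)

Sum-scale : ∀ (xs : List A) a (g : A → ℚ) → Sum xs (λ x → a * g x) ≡ a * Sum xs g
Sum-scale []       a g = sym (*-zeroʳ a)
Sum-scale (x ∷ xs) a g = trans (cong (a * g x +_) (Sum-scale xs a g)) (distrib a (g x) (Sum xs g))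
  where
  distrib : ∀ a u v → a * u + a * v ≡ a * (u + v)
  distrib = solve-∀ ℚ-ring

Sum-add : ∀ (xs : List A) (g h : A → ℚ) → Sum xs (λ x → g x + h x) ≡ Sum xs g + Sum xs h
Sum-add []       g h = refl
Sum-add (x ∷ xs) g h =
  trans (cong (g x + h x +_) (Sum-add xs g h)) (regroup (g x) (h x) (Sum xs g) (Sum xs h))
  where
  regroup : ∀ u v w z → (u + v) + (w + z) ≡ (u + w) + (v + z)
  regroup = solve-∀ ℚ-ring

Sum-swap : ∀ (xs : List A) (ys : List A′) (g : A → A′ → ℚ) →
  Sum xs (λ x → Sum ys (g x)) ≡ Sum ys (λ y → Sum xs (λ x → g x y))
Sum-swap []       ys g = sym (Sum-zero ys (λ _ → refl))
Sum-swap (x ∷ xs) ys g =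
  trans (cong (Sum ys (g x) +_) (Sum-swap xs ys g)) (sym (Sum-add ys (g x) _))

fromℕℚ-sum : ∀ (xs : List A) (g : A → ℕ) → fromℕℚ (sumℕ (map g xs)) ≡ Sum xs (fromℕℚ ∘ g)
fromℕℚ-sum []       g = refl
fromℕℚ-sum (x ∷ xs) g =
  trans (fromℕℚ-+ (g x) (sumℕ (map g xs))) (cong (fromℕℚ (g x) +_) (fromℕℚ-sum xs g))

when : Bool → ℚ → ℚ
when b v = if b then v else 0ℚ

∧-true : ∀ {a b} → a ∧ b ≡ true → a ≡ true × b ≡ true
∧-true {true} {true} _ = refl , refl

∧-intro : ∀ {a b} → a ≡ true → b ≡ true → a ∧ b ≡ true
∧-intro refl refl = refl

Bool-iff : ∀ {a b} → (a ≡ true → b ≡ true) → (b ≡ true → a ≡ true) → a ≡ b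
Bool-iff {true}  {b}     f g = sym (f refl)
Bool-iff {false} {false} f g = refl
Bool-iff {false} {true}  f g = g refl

not-true : ∀ {a} → (a ≡ true → false ≡ true) → a ≡ false
not-true {false} h = refl
not-true {true}  h = sym (h refl)

Sum-++ : ∀ (xs ys : List A) (g : A → ℚ) → Sum (xs ++ ys) g ≡ Sum xs g + Sum ys g
Sum-++ []       ys g = sym (+-identityˡ _)
Sum-++ (x ∷ xs) ys g = trans (cong (g x +_) (Sum-++ xs ys g)) (sym (+-assoc (g x) _ _))

Sum-map : ∀ (xs : List A) (f : A → B) (g : B → ℚ) → Sum (map f xs) g ≡ Sum xs (g ∘ f)
Sum-map xs f g = cong sumℚ (sym (map-∘ xs))

Sum-replicate : ∀ m (x : A) (g : A → ℚ) → Sum (replicate m x) g ≡ fromℕℚ m * g x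
Sum-replicate zero    x g = sym (*-zeroˡ (g x))
Sum-replicate (suc m) x g = begin
  g x + Sum (replicate m x) g     ≡⟨ cong₂ _+_ (sym (*-identityˡ (g x))) (Sum-replicate m x g) ⟩
  1ℚ * g x + fromℕℚ m * g x       ≡⟨ sym (*-distribʳ-+ (g x) 1ℚ (fromℕℚ m)) ⟩
  (1ℚ + fromℕℚ m) * g x           ≡⟨ cong (_* g x) (sym (fromℕℚ-+ 1 m)) ⟩
  fromℕℚ (suc m) * g x ∎
  where open ≡-Reasoning

Sum-lookup : ∀ (xs : List A) (g : A → ℚ) → Sum (allFin (length xs)) (g ∘ lookup xs) ≡ Sum xs g
Sum-lookup xs g = cong sumℚ (begin
  map (g ∘ lookup xs) (allFin (length xs))       ≡⟨ map-∘ (allFin (length xs)) ⟩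
  map g (map (lookup xs) (allFin (length xs)))   ≡⟨ cong (map g) (map-tabulate (λ i → i) (lookup xs)) ⟩
  map g (List.tabulate (lookup xs))    ≡⟨ cong (map g) (tabulate-lookup xs) ⟩
  map g xs ∎)
  where open ≡-Reasoning

neg1^-square : ∀ m → neg1^ m * neg1^ m ≡ 1ℚ
neg1^-square zero    = refl
neg1^-square (suc m) = trans (neg² (neg1^ m)) (neg1^-square m)
  where
  neg² : ∀ a → - a * - a ≡ a * a
  neg² = solve-∀ ℚ-ring

-- Brings side conditions to the ring solver: an identity valid only when h = 0 is proved as a
-- polynomial identity with an explicit error term `h * p`, which is then removed here.
drop-null : ∀ e p {h} → h ≡ 0ℚ → e + h * p ≡ e
drop-null e p refl = trans (cong (e +_) (*-zeroˡ p)) (+-identityʳ e)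

difference-zero : ∀ {u v : ℚ} → u ≡ v → u + - v ≡ 0ℚ
difference-zero {u} refl = +-inverseʳ u

module _ {n} (x y : Fin n) where
  ≟-refl : x ≡ y → ⌊ x ≟ y ⌋ ≡ true
  ≟-refl e with x ≟ y
  ... | yes _ = refl
  ... | no ne = ⊥-elim (ne e)

  ≟-false : ¬ x ≡ y → ⌊ x ≟ y ⌋ ≡ false
  ≟-false ne with x ≟ y
  ... | yes e = ⊥-elim (ne e)
  ... | no _  = refl

true≢false : ∀ {b} → b ≡ true → b ≡ false → ⊥
true≢false refl ()

≡ᵇ-true : ∀ {m n} → m ≡ n → (m ≡ᵇ n) ≡ true
≡ᵇ-true {m} {n} e = Equivalence.to T-≡ (ℕ.≡⇒≡ᵇ m n e)

≡ᵇ-false : ∀ {m n} → ¬ m ≡ n → (m ≡ᵇ n) ≡ false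
≡ᵇ-false {m} {n} ne = not-true (λ h → ⊥-elim (ne (ℕ.≡ᵇ⇒≡ m n (Equivalence.from T-≡ h))))

≤ᵇ-true : ∀ {m n} → m ≤ n → (m ≤ᵇ n) ≡ true
≤ᵇ-true h = Equivalence.to T-≡ (ℕ.≤⇒≤ᵇ h)

≤ᵇ-true⁻¹ : ∀ {m n} → (m ≤ᵇ n) ≡ true → m ≤ n
≤ᵇ-true⁻¹ {m} {n} h = ℕ.≤ᵇ⇒≤ m n (Equivalence.from T-≡ h)

≤ᵇ-false : ∀ {m n} → n < m → (m ≤ᵇ n) ≡ false
≤ᵇ-false {m} {n} lt = not-true (λ h → ⊥-elim (ℕ.<⇒≱ lt (≤ᵇ-true⁻¹ {m} {n} h)))

-- Maximal runs and even sets

data Lead (b : Bool) : Subset n → ℕ → Set where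
  end  : Lead b [] 0
  stop : Lead b (not b ∷ S) 0
  step : Lead b S m → Lead b (b ∷ S) (suc m)

-- Run b fr S i m: bits i, …, i+m-1 (counted from 0) form a maximal run of b,
-- possibly empty; fr tells whether a run may start at the very first bit.
data Run (b : Bool) : Bool → Subset n → ℕ → ℕ → Set where
  here : Lead b S m → Run b true S 0 m
  skip : Run b (x xor b) S i m → Run b fr (x ∷ S) (suc i) m

LeftEnd : Bool → Bool → Subset n → ℕ → Set
LeftEnd b fr S zero    = fr ≡ true
LeftEnd b fr S (suc i) = inS S (suc i) ≡ not b

RightEnd : Bool → ∀ {n} → Subset n → ℕ → Set
RightEnd b {n} S ℓ = ℓ ≡ n ⊎ inS S (suc ℓ) ≡ not b

Within : Bool → Subset n → ℕ → ℕ → Set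
Within b S i ℓ = ∀ j → i < j → j ≤ ℓ → inS S j ≡ b

private
  lift-right : ∀ {n} {S : Subset n} → RightEnd b S ℓ → RightEnd b (x ∷ S) (suc ℓ)
  lift-right (inj₁ e) = inj₁ (cong suc e)
  lift-right (inj₂ e) = inj₂ e

  lower-right : ∀ {n} {S : Subset n} → RightEnd b (x ∷ S) (suc ℓ) → RightEnd b S ℓ
  lower-right (inj₁ e) = inj₁ (ℕ.suc-injective e)
  lower-right (inj₂ e) = inj₂ e

  lower-within : Within b (x ∷ S) (suc i) (suc ℓ) → Within b S i ℓ
  lower-within w (suc j) i<j j≤ℓ = w (suc (suc j)) (s≤s i<j) (s≤s j≤ℓ)

to-lead : ∀ b (S : Subset n) ℓ → ℓ ≤ n → Within b S 0 ℓ → RightEnd b S ℓ → Lead b S ℓ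
to-lead b []      zero    _ _ _ = end
to-lead b (x ∷ S) zero    _ _ (inj₂ refl) = stop
to-lead b (x ∷ S) (suc ℓ) (s≤s ℓ≤n) w r with w 1 (s≤s z≤n) (s≤s z≤n)
... | refl = step (to-lead b S ℓ ℓ≤n
               (λ { (suc j) _ j≤ℓ → w (suc (suc j)) (s≤s z≤n) (s≤s j≤ℓ) }) (lower-right {x = x} {S = S} r))

to-run : ∀ b fr (S : Subset n) i m → i +ℕ m ≤ n → Within b S i (i +ℕ m) →
  LeftEnd b fr S i → RightEnd b S (i +ℕ m) → Run b fr S i m
to-run b fr S zero m m≤n w refl r = here (to-lead b S m m≤n w r)
to-run b fr (x ∷ S) (suc i) m (s≤s le) w l r =
  -- A run of `b` may begin right after the bit `x` exactly when `x` differs from `b`, that is, when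
  -- `x xor b` is true.
  skip (to-run b (x xor b) S i m le (lower-within w) (left i l) (lower-right {x = x} {S = S} r))
  where
  left : ∀ i → inS (x ∷ S) (suc i) ≡ not b → LeftEnd b (x xor b) S i
  left (suc i) e = e
  left zero    e = lemma x b e
    where
    lemma : ∀ x b → x ≡ not b → x xor b ≡ true
    lemma true  false _ = refl
    lemma false true  _ = refl

from-lead : ∀ {n} {S : Subset n} → Lead b S m → m ≤ n × Within b S 0 m × RightEnd b S m
from-lead end  = z≤n , (λ { _ (s≤s _) () }) , inj₁ refl
from-lead stop = z≤n , (λ { _ (s≤s _) () }) , inj₂ refl
from-lead {b = b} (step {S = S} L) with from-lead L
... | m≤n , w , r = s≤s m≤n , w′ , lift-right {x = b} {S = S} r
  where
  w′ : Within b (b ∷ S) 0 _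
  w′ (suc zero)    _ _         = refl
  w′ (suc (suc j)) _ (s≤s j≤m) = w (suc j) (s≤s z≤n) j≤m

from-run : ∀ {n} {S : Subset n} → Run b fr S i m →
  i +ℕ m ≤ n × Within b S i (i +ℕ m) × LeftEnd b fr S i × RightEnd b S (i +ℕ m)
from-run (here L) with from-lead L
... | m≤n , w , r = m≤n , w , refl , r
from-run {b = b} (skip {x = x} {S = S} {i = i} {m = m} R) with from-run R
... | le , w , l , r = s≤s le , w′ , left i l , lift-right {x = x} {S = S} r
  where
  w′ : Within b (x ∷ S) (suc i) (suc (i +ℕ m))
  w′ (suc (suc j)) (s≤s i<j) (s≤s j≤m) = w (suc j) i<j j≤m
  left : ∀ i → LeftEnd b (x xor b) S i → inS (x ∷ S) (suc i) ≡ not b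
  left (suc i) e = e
  left zero    e = lemma x b e
    where
    lemma : ∀ x b → x xor b ≡ true → x ≡ not b
    lemma true  false _ = refl
    lemma false true  _ = refl

-- `MaxRun` counts from 1 and gives both end points, `Run` counts from 0 and gives a length. As an
-- eliminator into an arbitrary `P` it spares its users the index equations.
maxRun⇒run : ∀ {n} {b} {S : Subset n} {i ℓ} → MaxRun b S i ℓ →
  (P : ℕ → ℕ → Set) → (∀ i m → Run b true S i (suc m) → P (suc i) (i +ℕ suc m)) → P i ℓ
maxRun⇒run {n} {b} {S} {suc i} {suc ℓ} (_ , s≤s i≤ℓ , ℓ≤n , w , l , r) P use
  with ℓ ∸ i | ℕ.m+[n∸m]≡n i≤ℓ
... | m | refl = subst (P (suc i)) (ℕ.+-suc i m) (use i m
      (to-run b true S i (suc m)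
        (subst (_≤ n) (sym (ℕ.+-suc i m)) ℓ≤n)
        (λ j i<j j≤ → w j i<j (subst (j ≤_) (ℕ.+-suc i m) j≤))
        (left i l)
        (subst (RightEnd b S) (sym (ℕ.+-suc i m)) r)))
  where
  left : ∀ i → suc i ≡ 1 ⊎ inS S i ≡ not b → LeftEnd b true S i
  left zero    _        = refl
  left (suc i) (inj₂ e) = e

run⇒maxRun : ∀ {n} {b} {S : Subset n} {i m} → Run b true S i (suc m) →
  MaxRun b S (suc i) (i +ℕ suc m)
run⇒maxRun {b = b} {S} {i} {m} R with from-run R
... | le , w , l , r =
  s≤s z≤n , subst (suc i ≤_) (sym (ℕ.+-suc i m)) (s≤s (ℕ.m≤m+n i m)) , le , w , left i l , r
  where
  left : ∀ i → LeftEnd b true S i → suc i ≡ 1 ⊎ inS S i ≡ not b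
  left zero    _ = inj₁ refl
  left (suc i) e = inj₂ e

odd : ℕ → Bool
odd zero    = false
odd (suc n) = not (odd n)

odd⇒2∣ : ∀ m → odd m ≡ false → 2 ∣ m
odd⇒2∣ zero e = divides 0 refl
odd⇒2∣ (suc (suc m)) e with odd⇒2∣ m (trans (sym (not-involutive (odd m))) e)
... | divides c refl = divides (suc c) refl

2∣⇒odd : ∀ {m} → 2 ∣ m → odd m ≡ false
2∣⇒odd (divides c refl) = double c
  where
  double : ∀ c → odd (c *ℕ 2) ≡ false
  double zero    = refl
  double (suc c) = trans (not-involutive (odd (c *ℕ 2))) (double c)

-- p is the parity (true for odd) of the run of elements read just before S.
even : Bool → Subset n → Bool
even p []          = not p
even p (false ∷ S) = not p ∧ even false S
even p (true ∷ S)  = even (not p) S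

-- The elements read before `S` belong to the same run as its leading ones, and acceptance forces
-- their total number to be even.
even-lead : ∀ p → even p S ≡ true → Lead true S m → odd m ≡ p
even-lead false e end  = refl
even-lead false e stop = refl
even-lead p e (step L) = trans (cong not (even-lead (not p) e L)) (not-involutive p)

even-run : ∀ p → even p S ≡ true → (fr ≡ true → p ≡ false) → Run true fr S i m →
  odd m ≡ false
even-run p e h (here L) = trans (even-lead p e L) (h refl)
even-run false e h (skip {x = false} R) = even-run false e (λ _ → refl) R
even-run p e h (skip {x = true} R) = even-run (not p) e (λ ()) R

weaken : Run b false S i m → Run b true S i m
weaken (skip R) = skip R

-- The first hypothesis concerns the run that crosses the current position, the second all runs that
-- start later.
runs-even : ∀ p (S : Subset n) → (∀ {m} → Lead true S m → odd m ≡ p) →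
  (∀ {i m} → Run true false S i m → odd m ≡ false) → even p S ≡ true
runs-even p []          h₀ h₁ = cong not (sym (h₀ end))
runs-even p (false ∷ S) h₀ h₁ with h₀ stop
... | refl = runs-even false S (λ L → h₁ (skip (here L))) (λ R → h₁ (skip (weaken R)))
runs-even p (true ∷ S)  h₀ h₁ =
  runs-even (not p) S (λ {m} L → trans (sym (not-involutive (odd m))) (cong not (h₀ (step L))))
    (λ R → h₁ (skip R))

even⇒IsEven : (S : Subset n) → even false S ≡ true → IsEven S
even⇒IsEven S e i ℓ M = maxRun⇒run {S = S} M (λ i ℓ → 2 ∣ suc ℓ ∸ i)
  (λ i m R → subst (2 ∣_) (sym (ℕ.m+n∸m≡n i (suc m)))
    (odd⇒2∣ (suc m) (even-run {S = S} false e (λ _ → refl) R)))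

IsEven⇒even : (S : Subset n) → IsEven S → even false S ≡ true
IsEven⇒even S e = runs-even false S (λ L → run (here L)) (λ R → run (weaken R))
  where
  run : ∀ {i m} → Run true true S i m → odd m ≡ false
  run {m = zero}          R = refl
  run {i = i} {m = suc m} R =
    2∣⇒odd (subst (2 ∣_) (ℕ.m+n∸m≡n i (suc m)) (e (suc i) (i +ℕ suc m) (run⇒maxRun R)))

-- Sums over all subsets, by recursion on the first bit

ΣS : (n : ℕ) → (Subset n → ℚ) → ℚ
ΣS zero    g = g []
ΣS (suc n) g = ΣS n (g ∘ (false ∷_)) + ΣS n (g ∘ (true ∷_))

Sum-allSubsets : ∀ n (g : Subset n → ℚ) → Sum (allSubsets n) g ≡ ΣS n g
Sum-allSubsets zero    g = +-identityʳ (g [])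
Sum-allSubsets (suc n) g = trans (Sum-++ (map (false ∷_) (allSubsets n)) _ g)
  (cong₂ _+_ (trans (Sum-map (allSubsets n) (false ∷_) g) (Sum-allSubsets n (g ∘ (false ∷_))))
             (trans (Sum-map (allSubsets n) (true ∷_) g) (Sum-allSubsets n (g ∘ (true ∷_)))))

ΣS-cong : ∀ n {g h : Subset n → ℚ} → (∀ S → g S ≡ h S) → ΣS n g ≡ ΣS n h
ΣS-cong zero    e = e []
ΣS-cong (suc n) e = cong₂ _+_ (ΣS-cong n (λ S → e (false ∷ S))) (ΣS-cong n (λ S → e (true ∷ S)))

ΣS-lin : ∀ n a b (g h : Subset n → ℚ) →
  ΣS n (λ S → a * g S + b * h S) ≡ a * ΣS n g + b * ΣS n h
ΣS-lin zero    a b g h = refl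
ΣS-lin (suc n) a b g h = trans
  (cong₂ _+_ (ΣS-lin n a b (g ∘ (false ∷_)) (h ∘ (false ∷_)))
             (ΣS-lin n a b (g ∘ (true ∷_)) (h ∘ (true ∷_))))
  (regroup a b (ΣS n (g ∘ (false ∷_))) (ΣS n (h ∘ (false ∷_)))
               (ΣS n (g ∘ (true ∷_))) (ΣS n (h ∘ (true ∷_))))
  where
  regroup : ∀ a b u v w z → (a * u + b * v) + (a * w + b * z) ≡ a * (u + w) + b * (v + z)
  regroup = solve-∀ ℚ-ring

-- The relations as linear systems, and their equivalence

-- Membership in `V` plays the part of being zero in the quotient by `V`. The field `resp` stands in
-- for function extensionality.
record IsSubspace {X : Set} (V : (X → ℚ) → Set) : Set where
  field
    resp  : ∀ {a b} → (∀ x → a x ≡ b x) → V a → V b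
    zero∈ : V (λ _ → 0ℚ)
    add   : ∀ {a b} → V a → V b → V (λ x → a x + b x)
    scale : ∀ c {a} → V a → V (λ x → c * a x)

  multiple : ∀ c {a b} → (∀ x → c * a x ≡ b x) → V a → V b
  multiple c e va = resp e (scale c va)

  combine : ∀ c d {a b e} → (∀ x → c * a x + d * b x ≡ e x) → V a → V b → V e
  combine c d e va vb = resp e (add (scale c va) (scale d vb))

ℚ-zero : IsSubspace {⊤} (λ φ → φ tt ≡ 0ℚ)
ℚ-zero = record
  { resp  = λ e p → trans (sym (e tt)) p
  ; zero∈ = refl
  ; add   = λ p r → cong₂ _+_ p r
  ; scale = λ c p → trans (cong (c *_) p) (*-zeroʳ c)
  }

module Systems {X : Set} {V : (X → ℚ) → Set} (V-sub : IsSubspace V)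
               (k q : ℚ) (2kq : q * (k + k) + 1ℚ ≡ 0ℚ) where
  open IsSubspace V-sub

  Family : ℕ → Set
  Family n = Subset n → X → ℚ

  -- Left side of the relation for a gap that ends at the last position read: there ℓ = p, so
  -- (-1)^(ℓ+1) is `- τ`.
  closing : ∀ {n} → ℚ → ℚ → Family n → Family n → Family n
  closing σ τ f s T x = k * (σ + - τ) * f T x + s T x

  -- The next position p+1 joins the gap and adds its term (-1)^(p+1) f, whose sign is `- τ`.
  extend : ∀ {n} → ℚ → Family (suc n) → Family (suc n) → Family n
  extend τ f s T x = s (false ∷ T) x + - τ * f (true ∷ T) x

  -- One position of the sum of q^|T| f_T over T containing the complement of S: a position in S is
  -- free to lie in T or not.
  merge : ∀ {n} → Family (suc n) → Family n
  merge f T x = f (false ∷ T) x + q * f (true ∷ T) x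

  -- The equations (1) for the gaps that are open at, or start after, the
  -- current position: f has the prefix already read plugged in, s collects the
  -- alternating sum over the positions of the open gap, and σ, τ are the signs
  -- (-1)^(i-1) and (-1)^p for a gap starting at i with p positions read so far.
  Eqs : ℚ → ℚ → (n : ℕ) → Family n → Family n → Set
  Eqs σ τ zero    f s = V (closing σ τ f s [])
  Eqs σ τ (suc n) f s =
      (∀ T → V (closing σ τ f s (true ∷ T)))
    × Eqs (- τ) (- τ) n (f ∘ (true ∷_)) (λ _ _ → 0ℚ)
    × Eqs σ (- τ) n (f ∘ (false ∷_)) (extend τ f s)

  -- The conditions L_S = 0 for non-even S, read position by position; the two
  -- predicates differ in the parity of the current run of elements of S.
  EvenNull OddNull : (n : ℕ) → Family n → Set
  EvenNull zero    f = ⊤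
  EvenNull (suc n) f = EvenNull n (f ∘ (true ∷_)) × OddNull n (merge f)
  OddNull  zero    f = V (f [])
  OddNull  (suc n) f = (∀ T → V (f (true ∷ T))) × EvenNull n (f ∘ (false ∷_))

  private
    merge-lin : ∀ a b q fF fT gF gT hF hT →
      1ℚ * (hF + - (a * fF + b * gF)) + q * (hT + - (a * fT + b * gT))
        ≡ (hF + q * hT) + - (a * (fF + q * fT) + b * (gF + q * gT))
    merge-lin = solve-∀ ℚ-ring

    undo : ∀ h a b f g → 1ℚ * (1ℚ * (h + - (a * f + b * g)) + a * f) + b * g ≡ h
    undo = solve-∀ ℚ-ring

  V-lin : ∀ a b {f g h : X → ℚ} → V (λ x → h x + - (a * f x + b * g x)) →
          V f → V g → V h
  V-lin a b {f} {g} {h} d vf vg =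
    combine 1ℚ b (λ x → undo (h x) a b (f x) (g x))
      (combine 1ℚ a (λ _ → refl) d vf) vg

  mutual
    -- The combination is required only modulo `V`, because the inductions below identify families
    -- only up to terms already known to be null. With b = 0 this transports nullity along such an
    -- identification.
    EvenNull-lin : ∀ n a b {f g h : Family n} →
      (∀ T → V (λ x → h T x + - (a * f T x + b * g T x))) →
      EvenNull n f → EvenNull n g → EvenNull n h
    EvenNull-lin zero    a b d _ _ = tt
    EvenNull-lin (suc n) a b {f} {g} {h} d (fT , fF) (gT , gF) =
      EvenNull-lin n a b (λ T → d (true ∷ T)) fT gT ,
      OddNull-lin n a b
        (λ T → combine 1ℚ q
          (λ x → merge-lin a b q (f (false ∷ T) x) (f (true ∷ T) x)
            (g (false ∷ T) x) (g (true ∷ T) x) (h (false ∷ T) x) (h (true ∷ T) x))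
          (d (false ∷ T)) (d (true ∷ T)))
        fF gF

    OddNull-lin : ∀ n a b {f g h : Family n} →
      (∀ T → V (λ x → h T x + - (a * f T x + b * g T x))) →
      OddNull n f → OddNull n g → OddNull n h
    OddNull-lin zero    a b d vf vg = V-lin a b (d []) vf vg
    OddNull-lin (suc n) a b d (fT , fF) (gT , gF) =
      (λ T → V-lin a b (d (true ∷ T)) (fT T) (gT T)) ,
      EvenNull-lin n a b (λ T → d (false ∷ T)) fF gF

  -- Up to terms known to vanish, these are the sums of the transform of f over the
  -- subsets of the open gap whose last part is an odd (dead), respectively even
  -- (live), gap and whose other gaps are even: closing the gap now forces the
  -- dead part, and nothing else, to be zero.
  dead live : ∀ {n} → ℚ → ℚ → Family n → Family n → Family n
  dead σ τ f s T x = - q * σ * closing σ τ f s T x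
  live σ τ f s T x = dead σ τ f s T x + σ * τ * f T x

  private
    -- In this and the following identities, a trailing multiple of τ² - 1, σ² - 1 or 2kq + 1 is an
    -- error term that vanishes for the actual signs and constants.
    live-restart : ∀ k q σ τ f s →
      1ℚ * (- q * σ * (k * (σ + - τ) * f + s)) ≡
      (- q * σ * (k * (σ + - τ) * f + s) + σ * τ * f) +
        - (σ * τ * (- q * (- τ) * (k * (- τ + - (- τ)) * f + 0ℚ) + - τ * - τ * f) + 0ℚ *
           (- q * (- τ) * (k * (- τ + - (- τ)) * f + 0ℚ) + - τ * - τ * f))
        + (τ * τ + - 1ℚ) * (σ * τ * f)
    live-restart = solve-∀ ℚ-ring

    restart-live : ∀ k q σ τ f s →
      - (σ * τ) * (- q * σ * (k * (σ + - τ) * f + s)) ≡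
      (- q * (- τ) * (k * (- τ + - (- τ)) * f + 0ℚ) + - τ * - τ * f) +
        - (σ * τ * (- q * σ * (k * (σ + - τ) * f + s) + σ * τ * f) + 0ℚ *
           (- q * σ * (k * (σ + - τ) * f + s) + σ * τ * f))
        + (σ * σ + - 1ℚ) * (τ * τ * f)
    restart-live = solve-∀ ℚ-ring

    dead-step : ∀ k q σ τ fF sF fT sT →
      q * (- q * σ * (k * (σ + - τ) * fT + sT)) ≡
      ((- q * σ * (k * (σ + - τ) * fF + sF) + σ * τ * fF) +
        q * (- q * σ * (k * (σ + - τ) * fT + sT) + σ * τ * fT)) +
      - (1ℚ * (- q * σ * (k * (σ + - (- τ)) * fF + (sF + - τ * fT))) + 0ℚ *
         (- q * σ * (k * (σ + - (- τ)) * fF + (sF + - τ * fT))))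
      + (q * (k + k) + 1ℚ) * (- σ * τ * fF)
    dead-step = solve-∀ ℚ-ring

    step-dead : ∀ k q σ τ fF sF fT sT →
      - q * (- q * σ * (k * (σ + - τ) * fT + sT)) ≡
      (- q * σ * (k * (σ + - (- τ)) * fF + (sF + - τ * fT))) +
      - (1ℚ * ((- q * σ * (k * (σ + - τ) * fF + sF) + σ * τ * fF) +
        q * (- q * σ * (k * (σ + - τ) * fT + sT) + σ * τ * fT)) + 0ℚ *
        ((- q * σ * (k * (σ + - τ) * fF + sF) + σ * τ * fF) +
        q * (- q * σ * (k * (σ + - τ) * fT + sT) + σ * τ * fT)))
      + (q * (k + k) + 1ℚ) * (σ * τ * fF)
    step-dead = solve-∀ ℚ-ring

    live-step : ∀ k q σ τ fF sF fT sT →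
      q * (- q * σ * (k * (σ + - τ) * fT + sT)) ≡
      (- q * σ * (k * (σ + - τ) * fF + sF)) +
      - (1ℚ * (- q * σ * (k * (σ + - (- τ)) * fF + (sF + - τ * fT)) + σ * - τ * fF)
        + - q * (- q * σ * (k * (σ + - τ) * fT + sT) + σ * τ * fT))
      + (q * (k + k) + 1ℚ) * (- σ * τ * fF)
    live-step = solve-∀ ℚ-ring

    step-live : ∀ k q σ τ fF sF fT sT →
      - q * (- q * σ * (k * (σ + - τ) * fT + sT)) ≡
      (- q * σ * (k * (σ + - (- τ)) * fF + (sF + - τ * fT)) + σ * - τ * fF) +
      - (1ℚ * (- q * σ * (k * (σ + - τ) * fF + sF))
        + q * (- q * σ * (k * (σ + - τ) * fT + sT) + σ * τ * fT))
      + (q * (k + k) + 1ℚ) * (σ * τ * fF)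
    step-live = solve-∀ ℚ-ring

    unscale : ∀ k q σ τ f s →
      σ * (k + k) * (- q * σ * (k * (σ + - τ) * f + s)) ≡
      (k * (σ + - τ) * f + s) + (σ * σ + - 1ℚ) * ((k * (σ + - τ) * f + s))
        + (q * (k + k) + 1ℚ) * (- (σ * σ) * (k * (σ + - τ) * f + s))
    unscale = solve-∀ ℚ-ring

    nullO : ∀ k q τ f g →
      0ℚ ≡ (- q * - τ * (k * (- τ + - (- τ)) * f + 0ℚ)) + - (0ℚ * g + 0ℚ * g)
    nullO = solve-∀ ℚ-ring

    sign² : ∀ τ → - τ * - τ ≡ τ * τ
    sign² = solve-∀ ℚ-ring

  -- Both families are carried along because lengthening the gap by one position exchanges their
  -- roles. Modulo the closed equations, which make `dead` null on `true ∷ T`, merging `live` gives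
  -- the next `dead`, and `dead` on `false ∷ T` is the next `live` minus q times `live` on
  -- `true ∷ T`.
  Eqs⇒Null : ∀ n {σ τ} {f s : Family n} → σ * σ ≡ 1ℚ → τ * τ ≡ 1ℚ → Eqs σ τ n f s →
    EvenNull n (live σ τ f s) × OddNull n (dead σ τ f s)
  Eqs⇒Null zero {σ} hσ hτ v = tt , scale (- q * σ) v
  Eqs⇒Null (suc n) {σ} {τ} {f} {s} hσ hτ (closed , restarted , extended) =
    (liveT ,
     OddNull-lin n 1ℚ 0ℚ
       (λ T → multiple q
         (λ x → trans (dead-step k q σ τ (f (false ∷ T) x) (s (false ∷ T) x)
                         (f (true ∷ T) x) (s (true ∷ T) x))
                      (drop-null _ _ 2kq))
         (deadT T))
       (proj₂ nextNull) (proj₂ nextNull)) ,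
    (deadT ,
     EvenNull-lin n 1ℚ (- q)
       (λ T → multiple q
         (λ x → trans (live-step k q σ τ (f (false ∷ T) x) (s (false ∷ T) x)
                         (f (true ∷ T) x) (s (true ∷ T) x))
                      (drop-null _ _ 2kq))
         (deadT T))
       (proj₁ nextNull) liveT)
    where
    restartNull = Eqs⇒Null n (trans (sign² τ) hτ) (trans (sign² τ) hτ) restarted
    nextNull = Eqs⇒Null n hσ (trans (sign² τ) hτ) extended
    deadT : ∀ T → V (dead σ τ f s (true ∷ T))
    deadT T = scale (- q * σ) (closed T)
    -- Once an element closes the gap, `live` is στ f modulo `V`, while the `live` family of the
    -- empty gap that follows is f itself; they differ by a sign.
    liveT : EvenNull n (λ T → live σ τ f s (true ∷ T))
    liveT = EvenNull-lin n (σ * τ) 0ℚ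
      (λ T → multiple 1ℚ
        (λ x → trans (live-restart k q σ τ (f (true ∷ T) x) (s (true ∷ T) x))
                     (drop-null _ _ (difference-zero hτ)))
        (deadT T))
      (proj₁ restartNull) (proj₁ restartNull)

  -- The same exchange read backwards. The factor 2kσ undoes the scaling `- q * σ` in `dead` and so
  -- recovers `closing`.
  Null⇒Eqs : ∀ n {σ τ} {f s : Family n} → σ * σ ≡ 1ℚ → τ * τ ≡ 1ℚ →
    EvenNull n (live σ τ f s) → OddNull n (dead σ τ f s) → Eqs σ τ n f s
  Null⇒Eqs zero {σ} {τ} {f} {s} hσ hτ _ v =
    multiple (σ * (k + k))
      (λ x → trans (unscale k q σ τ (f [] x) (s [] x))
        (trans (drop-null _ _ 2kq) (drop-null _ _ (difference-zero hσ)))) v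
  Null⇒Eqs (suc n) {σ} {τ} {f} {s} hσ hτ (liveT , merged) (deadT , deadF) =
    (λ T → multiple (σ * (k + k))
      (λ x → trans (unscale k q σ τ (f (true ∷ T) x) (s (true ∷ T) x))
        (trans (drop-null _ _ 2kq) (drop-null _ _ (difference-zero hσ)))) (deadT T)) ,
    Null⇒Eqs n (trans (sign² τ) hτ) (trans (sign² τ) hτ)
      (EvenNull-lin n (σ * τ) 0ℚ
        (λ T → multiple (- (σ * τ))
          (λ x → trans (restart-live k q σ τ (f (true ∷ T) x) (s (true ∷ T) x))
                       (drop-null _ _ (difference-zero hσ)))
          (deadT T))
        liveT liveT)
      -- The `dead` family of an empty gap is identically zero, hence 0 times any family known to be
      -- null.
      (OddNull-lin n 0ℚ 0ℚ
        (λ T → resp (λ x → nullO k q τ (f (true ∷ T) x) (merge (live σ τ f s) T x)) zero∈)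
        merged merged) ,
    Null⇒Eqs n hσ (trans (sign² τ) hτ)
      (EvenNull-lin n 1ℚ q
        (λ T → multiple (- q)
          (λ x → trans (step-live k q σ τ (f (false ∷ T) x) (s (false ∷ T) x)
                         (f (true ∷ T) x) (s (true ∷ T) x))
                       (drop-null _ _ 2kq))
          (deadT T))
        deadF liveT)
      (OddNull-lin n 1ℚ 0ℚ
        (λ T → multiple (- q)
          (λ x → trans (step-dead k q σ τ (f (false ∷ T) x) (s (false ∷ T) x)
                         (f (true ∷ T) x) (s (true ∷ T) x))
                       (drop-null _ _ 2kq))
          (deadT T))
        merged merged)

  private
    closing-lin : ∀ a b c f s g u →
      a * (c * f + s) + b * (c * g + u) ≡ c * (a * f + b * g) + (a * s + b * u)
    closing-lin = solve-∀ ℚ-ring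
    extend-lin : ∀ a b τ s f u g →
      (a * s + b * u) + - τ * (a * f + b * g) ≡ a * (s + - τ * f) + b * (u + - τ * g)
    extend-lin = solve-∀ ℚ-ring

  Eqs-lin : ∀ n {σ τ} a b {f s g u h w : Family n} → Eqs σ τ n f s → Eqs σ τ n g u →
    (∀ T x → h T x ≡ a * f T x + b * g T x) → (∀ T x → w T x ≡ a * s T x + b * u T x) →
    Eqs σ τ n h w
  Eqs-lin zero {σ} {τ} a b {f} {s} {g} {u} e e′ h≡ w≡ = combine a b
    (λ x → trans (closing-lin a b (k * (σ + - τ)) (f [] x) (s [] x) (g [] x) (u [] x))
      (sym (cong₂ (λ y z → k * (σ + - τ) * y + z) (h≡ [] x) (w≡ [] x)))) e e′
  Eqs-lin (suc n) {σ} {τ} a b {f} {s} {g} {u} (c , r , e) (c′ , r′ , e′) h≡ w≡ =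
    (λ T → combine a b
      (λ x → trans (closing-lin a b (k * (σ + - τ)) (f (true ∷ T) x) (s (true ∷ T) x)
                                 (g (true ∷ T) x) (u (true ∷ T) x))
        (sym (cong₂ (λ y z → k * (σ + - τ) * y + z) (h≡ (true ∷ T) x) (w≡ (true ∷ T) x))))
      (c T) (c′ T)) ,
    Eqs-lin n a b r r′ (λ T → h≡ (true ∷ T)) (λ T x → zeros a b) ,
    Eqs-lin n a b e e′ (λ T → h≡ (false ∷ T))
      (λ T x → trans (cong₂ (λ y z → y + - τ * z) (w≡ (false ∷ T) x) (h≡ (true ∷ T) x))
        (extend-lin a b τ (s (false ∷ T) x) (f (true ∷ T) x) (u (false ∷ T) x) (g (true ∷ T) x)))
    where
    zeros : ∀ a b → 0ℚ ≡ a * 0ℚ + b * 0ℚ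
    zeros = solve-∀ ℚ-ring

  Eqs-zero : ∀ n {σ τ} → Eqs σ τ n (λ _ _ → 0ℚ) (λ _ _ → 0ℚ)
  Eqs-zero zero {σ} {τ} = resp (λ x → zeros (k * (σ + - τ))) zero∈
    where
    zeros : ∀ c → 0ℚ ≡ c * 0ℚ + 0ℚ
    zeros = solve-∀ ℚ-ring
  Eqs-zero (suc n) {σ} {τ} =
    (λ T → resp (λ x → zeros (k * (σ + - τ))) zero∈) , Eqs-zero n ,
    Eqs-lin n 0ℚ 0ℚ (Eqs-zero n) (Eqs-zero n) (λ _ _ → refl) (λ _ _ → more τ)
    where
    zeros : ∀ c → 0ℚ ≡ c * 0ℚ + 0ℚ
    zeros = solve-∀ ℚ-ring
    more : ∀ τ → 0ℚ + - τ * 0ℚ ≡ 0ℚ * 0ℚ + 0ℚ * 0ℚ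
    more = solve-∀ ℚ-ring

  Eqs-resp : ∀ n {σ τ} {f s h w : Family n} → Eqs σ τ n f s →
    (∀ T x → h T x ≡ f T x) → (∀ T x → w T x ≡ s T x) → Eqs σ τ n h w
  Eqs-resp n {f = f} {s} e h≡ w≡ = Eqs-lin n 1ℚ 0ℚ e e
    (λ T x → trans (h≡ T x) (once (f T x))) (λ T x → trans (w≡ T x) (once (s T x)))
    where
    once : ∀ a → a ≡ 1ℚ * a + 0ℚ * a
    once = solve-∀ ℚ-ring

  Eqs-sum : ∀ n {A : Set} (ys : List A) {σ τ} {f : A → Family n} →
    (∀ y → Eqs σ τ n (f y) (λ _ _ → 0ℚ)) →
    Eqs σ τ n (λ T x → Sum ys (λ y → f y T x)) (λ _ _ → 0ℚ)
  Eqs-sum n []       e = Eqs-zero n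
  Eqs-sum n (y ∷ ys) {f = f} e = Eqs-lin n 1ℚ 1ℚ (e y) (Eqs-sum n ys e)
    (λ T x → ones (f y T x) (Sum ys (λ y → f y T x))) (λ T x → refl)
    where
    ones : ∀ a b → a + b ≡ 1ℚ * a + 1ℚ * b
    ones = solve-∀ ℚ-ring

-- From the recursive system to relations indexed by gaps, and to the L-vector

sgn : ℚ → ℕ → ℚ
sgn τ zero    = τ
sgn τ (suc i) = sgn (- τ) i

alt : ℚ → ℕ → (ℕ → ℚ) → ℚ
alt τ zero    g = 0ℚ
alt τ (suc m) g = - τ * g 0 + alt (- τ) m (g ∘ suc)

alt-neg1^ : ∀ i m g →
  alt (neg1^ i) m g ≡ sumℚ (applyUpTo (λ j → neg1^ (suc i +ℕ j) * g j) m)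
alt-neg1^ i zero    g = refl
alt-neg1^ i (suc m) g = cong₂ _+_
  (cong (λ l → - neg1^ l * g 0) (sym (ℕ.+-identityʳ i)))
  (trans (alt-neg1^ (suc i) m (g ∘ suc))
    (cong sumℚ (applyUpTo-cong m (λ j → cong (λ l → - neg1^ l * g (suc j)) (sym (ℕ.+-suc i j))))))
  where
  applyUpTo-cong : ∀ m {u v : ℕ → ℚ} → (∀ j → u j ≡ v j) → applyUpTo u m ≡ applyUpTo v m
  applyUpTo-cong zero    e = refl
  applyUpTo-cong (suc m) e = cong₂ _∷_ (e 0) (applyUpTo-cong m (e ∘ suc))

sgn-neg : ∀ τ i → sgn (- τ) i ≡ - sgn τ i
sgn-neg τ zero    = refl
sgn-neg τ (suc i) = sgn-neg (- τ) i

sgn-1 : ∀ i → sgn 1ℚ i ≡ neg1^ i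
sgn-1 zero    = refl
sgn-1 (suc i) = trans (sgn-neg 1ℚ i) (cong -_ (sgn-1 i))

-- Blocks of the posets that detect the relations: `single` is an antichain,
-- `double` the disjoint union of two copies of an ordinal sum of two antichains.
data Word : ℕ → Set where
  []       : Word 0
  single∷_ : ∀ {n} → Word n → Word (suc n)
  double∷_ : ∀ {n} → Word n → Word (suc (suc n))

-- The flag numbers of the word poset whose antichains have N elements. In a `double` block each
-- rank has 2N elements, but a lower one lies below only the N upper ones of its own copy.
weight : ∀ {n} → ℚ → Word n → Subset n → ℚ
weight N []          []                  = 1ℚ
weight N (single∷ I) (false ∷ T)         = weight N I T
weight N (single∷ I) (true  ∷ T)         = N * weight N I T
weight N (double∷ I) (false ∷ false ∷ T) = weight N I T
weight N (double∷ I) (false ∷ true  ∷ T) = (N + N) * weight N I T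
weight N (double∷ I) (true  ∷ false ∷ T) = (N + N) * weight N I T
weight N (double∷ I) (true  ∷ true  ∷ T) = (N + N) * (N * weight N I T)

module Transform {X : Set} {V : (X → ℚ) → Set} (V-sub : IsSubspace V)
               (k q : ℚ) (2kq : q * (k + k) + 1ℚ ≡ 0ℚ) where
  open IsSubspace V-sub
  open Systems V-sub k q 2kq

  value : ∀ {n} → ℚ → Subset n → ℕ → ℕ → Family n → X → ℚ
  value τ S i m f x =
    k * (sgn τ i + - sgn τ (i +ℕ m)) * f S x + alt (sgn τ i) m (λ j → f (insS S (suc i +ℕ j)) x)

  -- The same for a gap that is already open: `s` holds the terms of its positions read so far.
  leadValue : ∀ {n} → ℚ → ℚ → Subset n → ℕ → Family n → Family n → X → ℚ
  leadValue σ τ S m f s x =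
    k * (σ + - sgn τ m) * f S x + (s S x + alt τ m (λ j → f (insS S (suc j)) x))

  private
    regroup : ∀ a b c d → a + ((b + c) + d) ≡ a + (b + (c + d))
    regroup = solve-∀ ℚ-ring

    pad : ∀ a b → a + b ≡ a + (b + 0ℚ)
    pad = solve-∀ ℚ-ring

  Eqs⇒lead : ∀ {n σ τ m} {f s : Family n} {S} → Eqs σ τ n f s → Lead false S m →
    V (leadValue σ τ S m f s)
  Eqs⇒lead {σ = σ} {τ} {f = f} {s} e end =
    resp (λ x → pad (k * (σ + - τ) * f [] x) (s [] x)) e
  Eqs⇒lead {σ = σ} {τ} {f = f} {s} (closed , _) (stop {S = S}) =
    resp (λ x → pad (k * (σ + - τ) * f (true ∷ S) x) (s (true ∷ S) x)) (closed S)
  Eqs⇒lead {σ = σ} {τ} {f = f} {s} (_ , _ , extended) (step {S = S} {m = m} L) =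
    resp (λ x → regroup (k * (σ + - sgn (- τ) m) * f (false ∷ S) x) (s (false ∷ S) x)
                  (- τ * f (true ∷ S) x) (alt (- τ) m (λ j → f (false ∷ insS S (suc j)) x)))
      (Eqs⇒lead extended L)

  -- If a gap may start at the current position, then nothing of it has been read: its sign σ is the
  -- current τ and its partial sum is zero.
  Eqs⇒run : ∀ {n σ τ i m fr} {f s : Family n} {S} → Eqs σ τ n f s →
    (fr ≡ true → σ ≡ τ × (∀ T x → s T x ≡ 0ℚ)) → Run false fr S i m → V (value τ S i m f)
  Eqs⇒run {σ = σ} {m = m} {f = f} {S = S} e h (here L) with h refl
  ... | refl , s≡0 = resp
    (λ x → cong (k * (σ + - sgn σ m) * f S x +_)
             (trans (cong (_+ alt σ m (λ j → f (insS S (suc j)) x)) (s≡0 S x)) (+-identityˡ _)))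
    (Eqs⇒lead e L)
  Eqs⇒run (_ , restarted , _) h (skip {x = true} R) =
    Eqs⇒run restarted (λ _ → refl , λ _ _ → refl) R
  Eqs⇒run (_ , _ , extended) h (skip {x = false} R) = Eqs⇒run extended (λ ()) R

  runs⇒Eqs : ∀ n {σ τ} {f s : Family n} →
    (∀ {S m} → Lead false S m → V (leadValue σ τ S m f s)) →
    (∀ {S i m} → Run false false S i m → V (value τ S i m f)) → Eqs σ τ n f s
  runs⇒Eqs zero {σ} {τ} {f} {s} h₀ h₁ =
    resp (λ x → sym (pad (k * (σ + - τ) * f [] x) (s [] x))) (h₀ end)
  runs⇒Eqs (suc n) {σ} {τ} {f} {s} h₀ h₁ =
    (λ T → resp (λ x → sym (pad (k * (σ + - τ) * f (true ∷ T) x) (s (true ∷ T) x)))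
             (h₀ (stop {S = T}))) ,
    runs⇒Eqs n
      (λ {S} {m} L → resp
        (λ x → cong (k * (- τ + - sgn (- τ) m) * f (true ∷ S) x +_) (sym (+-identityˡ _)))
        (h₁ (skip (here L))))
      (λ R → h₁ (skip (weaken R))) ,
    runs⇒Eqs n
      (λ {S} {m} L → resp
        (λ x → sym (regroup (k * (σ + - sgn (- τ) m) * f (false ∷ S) x) (s (false ∷ S) x)
                  (- τ * f (true ∷ S) x) (alt (- τ) m (λ j → f (false ∷ insS S (suc j)) x))))
        (h₀ (step L)))
      (λ R → h₁ (skip R))

  private
    cancel : ∀ k a f → 0ℚ ≡ k * (a + - a) * f + 0ℚ
    cancel = solve-∀ ℚ-ring

  empty-run : ∀ {n} τ (S : Subset n) i (f : Family n) → V (value τ S i 0 f)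
  empty-run τ S i f = resp
    (λ x → trans (cancel k (sgn τ i) (f S x))
      (cong (λ l → k * (sgn τ i + - sgn τ l) * f S x + 0ℚ) (sym (ℕ.+-identityʳ i)))) zero∈

  -- This is L_S up to sign: positions in S are summed over, positions outside S must lie in T and
  -- give a factor q.
  transform : ∀ {n} → Subset n → Family n → X → ℚ
  transform []          f = f []
  transform (true ∷ S)  f = transform S (merge f)
  transform (false ∷ S) f = λ x → q * transform S (f ∘ (true ∷_)) x

  transform-V : ∀ {n} (S : Subset n) {f : Family n} → (∀ T → V (f T)) → V (transform S f)
  transform-V []          v = v []
  transform-V (true ∷ S) {f} v = transform-V S
    (λ T → combine 1ℚ q (λ x → cong (_+ q * f (true ∷ T) x) (*-identityˡ (f (false ∷ T) x)))
             (v (false ∷ T)) (v (true ∷ T)))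
  transform-V (false ∷ S) v = scale q (transform-V S (λ T → v (true ∷ T)))

  private
    divide : ∀ q k a → - (k + k) * (q * a) ≡ a + (q * (k + k) + 1ℚ) * (- a)
    divide = solve-∀ ℚ-ring

    unmerge : ∀ q a b → 1ℚ * (a + q * b) + - q * b ≡ a
    unmerge = solve-∀ ℚ-ring

    merge-diff : ∀ q a b → q * b ≡ (a + q * b) + - (1ℚ * a + 0ℚ * a)
    merge-diff = solve-∀ ℚ-ring

    diff-merge : ∀ q a b → - q * b ≡ a + - (1ℚ * (a + q * b) + 0ℚ * (a + q * b))
    diff-merge = solve-∀ ℚ-ring

  V-divide : ∀ {a : X → ℚ} → V (λ x → q * a x) → V a
  V-divide = multiple (- (k + k)) (λ x → trans (divide q k _) (drop-null _ _ 2kq))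

  -- The transform is invertible: a non-element isolates q f on `true ∷ T`, and q is a unit;
  -- subtracting this from the merged family leaves f on `false ∷ T`.
  V-transform : ∀ n {f : Family n} → (∀ S → V (transform S f)) → ∀ T → V (f T)
  V-transform zero    v [] = v []
  V-transform (suc n) {f} v = λ where
      (true ∷ T)  → vT T
      (false ∷ T) → combine 1ℚ (- q)
        (λ x → unmerge q (f (false ∷ T) x) (f (true ∷ T) x))
        (V-transform n (λ S → v (true ∷ S)) T) (vT T)
    where
    vT : ∀ T → V (f (true ∷ T))
    vT = V-transform n (λ S → V-divide (v (false ∷ S)))

  mutual
    EvenNull⇒transform : ∀ {n} {f : Family n} → EvenNull n f →
      ∀ S → even false S ≡ false → V (transform S f)
    EvenNull⇒transform (_ , o) (true ∷ S)  e = OddNull⇒transform o S e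
    EvenNull⇒transform (t , _) (false ∷ S) e = scale q (EvenNull⇒transform t S e)

    OddNull⇒transform : ∀ {n} {f : Family n} → OddNull n f →
      ∀ S → even true S ≡ false → V (transform S f)
    OddNull⇒transform v [] e = v
    -- Since f is null on `true ∷ T`, the families `merge f` and `f ∘ (false ∷_)` agree modulo `V`.
    OddNull⇒transform {f = f} (t , ef) (true ∷ S) e = EvenNull⇒transform
      (EvenNull-lin _ 1ℚ 0ℚ
        (λ T → multiple q (λ x → merge-diff q (f (false ∷ T) x) (f (true ∷ T) x)) (t T)) ef ef)
      S e
    -- An odd run has just ended, so no completion of the set is even, and every f on `true ∷ T` is
    -- null.
    OddNull⇒transform (t , _) (false ∷ S) e = scale q (transform-V S t)

  mutual
    transform⇒EvenNull : ∀ n {f : Family n} →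
      (∀ S → even false S ≡ false → V (transform S f)) → EvenNull n f
    transform⇒EvenNull zero    v = tt
    transform⇒EvenNull (suc n) v =
      transform⇒EvenNull n (λ S e → V-divide (v (false ∷ S) e)) ,
      transform⇒OddNull n (λ S e → v (true ∷ S) e)

    transform⇒OddNull : ∀ n {f : Family n} →
      (∀ S → even true S ≡ false → V (transform S f)) → OddNull n f
    transform⇒OddNull zero    v = v [] refl
    transform⇒OddNull (suc n) {f} v =
      vT ,
      EvenNull-lin n 1ℚ 0ℚ
        (λ T → multiple (- q) (λ x → diff-merge q (f (false ∷ T) x) (f (true ∷ T) x)) (vT T))
        ef ef
      where
      vT : ∀ T → V (f (true ∷ T))
      -- For the same reason the transforms of all `S` are null here, and the transform can be
      -- inverted.
      vT = V-transform n (λ S → V-divide (v (false ∷ S) refl))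
      ef : EvenNull n (merge f)
      ef = transform⇒EvenNull n (λ S e → v (true ∷ S) e)

  -- Coefficients orthogonal to the flag vectors of all words

  ΣS-V : ∀ n (c : Subset n → ℚ) {f : Family n} → (∀ S → V (f S)) →
    V (λ x → ΣS n (λ S → c S * f S x))
  ΣS-V zero    c v = scale (c []) (v [])
  ΣS-V (suc n) c v =
    add (ΣS-V n (c ∘ (false ∷_)) (λ S → v (false ∷ S))) (ΣS-V n (c ∘ (true ∷_)) (λ S → v (true ∷ S)))

  Annihilates : ∀ {n} → (Subset n → ℚ) → Set
  Annihilates {n} c = ∀ (I : Word n) → ΣS n (λ S → c S * weight (k + k) I S) ≡ 0ℚ

  private
    combine-null : ∀ {a b} c d → a ≡ 0ℚ → b ≡ 0ℚ → c * a + d * b ≡ 0ℚ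
    combine-null c d refl refl = zeros c d
      where
      zeros : ∀ c d → c * 0ℚ + d * 0ℚ ≡ 0ℚ
      zeros = solve-∀ ℚ-ring

    change : ∀ q k cF cT w →
      (cT + - q * cF) * w ≡ - q * (cF * w) + - q * (cT * ((k + k) * w))
        + (q * (k + k) + 1ℚ) * (cT * w)
    change = solve-∀ ℚ-ring

    swap-merge : ∀ q cF cT fF fT →
      1ℚ * (cF * (fF + q * fT)) + 1ℚ * ((cT + - q * cF) * fT) ≡ 1ℚ * (cF * fF) + 1ℚ * (cT * fT)
    swap-merge = solve-∀ ℚ-ring

    ones : ∀ a b → 1ℚ * a + 1ℚ * b ≡ a + b
    ones = solve-∀ ℚ-ring

    factor : ∀ q a b → - q * a + - q * b ≡ - q * (a + b) + 0ℚ * 0ℚ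
    factor = solve-∀ ℚ-ring

  -- These are the coefficients of f on `true ∷ S` once f on `false ∷ S` is replaced by `merge f`
  -- minus q f on `true ∷ S`. A `single` block put before I tests them: as -qN = 1 for N = 2k, its
  -- equation times -q is the one wanted for I.
  true-part : ∀ {n} (c : Subset (suc n) → ℚ) → Annihilates c →
    Annihilates (λ S → c (true ∷ S) + - q * c (false ∷ S))
  true-part {n} c ann I = begin
    ΣS n (λ S → (c (true ∷ S) + - q * c (false ∷ S)) * weight (k + k) I S)
      ≡⟨ ΣS-cong n (λ S → trans (change q k (c (false ∷ S)) (c (true ∷ S)) (weight (k + k) I S))
           (drop-null _ _ 2kq)) ⟩
    ΣS n (λ S → - q * (c (false ∷ S) * weight (k + k) I S)
              + - q * (c (true ∷ S) * weight (k + k) (single∷ I) (true ∷ S)))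
      ≡⟨ ΣS-lin n (- q) (- q) _ _ ⟩
    - q * ΣS n (λ S → c (false ∷ S) * weight (k + k) I S)
      + - q * ΣS n (λ S → c (true ∷ S) * weight (k + k) (single∷ I) (true ∷ S))
      ≡⟨ factor q (ΣS n (λ S → c (false ∷ S) * weight (k + k) I S))
           (ΣS n (λ S → c (true ∷ S) * weight (k + k) (single∷ I) (true ∷ S))) ⟩
    - q * ΣS (suc n) (λ S → c S * weight (k + k) (single∷ I) S) + 0ℚ * 0ℚ
      ≡⟨ combine-null (- q) 0ℚ (ann (single∷ I)) refl ⟩
    0ℚ ∎
    where open ≡-Reasoning

  private
    double-single : ∀ N cFF cFT cTF cTT w →
      cFF * w ≡
      (1ℚ + 1ℚ) * (1ℚ * (1ℚ * (cFF * w) + 1ℚ * (cFT * (N * w)))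
                   + 1ℚ * (1ℚ * (cTF * (N * w)) + 1ℚ * (cTT * (N * (N * w)))))
      + - 1ℚ * (1ℚ * (1ℚ * (cFF * w) + 1ℚ * (cFT * ((N + N) * w)))
                   + 1ℚ * (1ℚ * (cTF * ((N + N) * w)) + 1ℚ * (cTT * ((N + N) * (N * w)))))
    double-single = solve-∀ ℚ-ring

  ΣS-sum : ∀ n (g h : Subset n → ℚ) → ΣS n (λ S → 1ℚ * g S + 1ℚ * h S) ≡ ΣS n g + ΣS n h
  ΣS-sum n g h = trans (ΣS-lin n 1ℚ 1ℚ g h) (ones (ΣS n g) (ΣS n h))

  -- The weights of a `double` block and of two `single` blocks agree on the sets
  -- avoiding both ranks and differ by a factor of 2 on all others.
  false-false-part : ∀ {n} (c : Subset (suc (suc n)) → ℚ) → Annihilates c →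
    Annihilates (λ S → c (false ∷ false ∷ S))
  false-false-part {n} c ann I = begin
    ΣS n (λ S → c (false ∷ false ∷ S) * weight N I S)
      ≡⟨ ΣS-cong n (λ S → double-single N (c (false ∷ false ∷ S)) (c (false ∷ true ∷ S))
           (c (true ∷ false ∷ S)) (c (true ∷ true ∷ S)) (weight N I S)) ⟩
    ΣS n _
      ≡⟨ ΣS-lin n (1ℚ + 1ℚ) (- 1ℚ) _ _ ⟩
    (1ℚ + 1ℚ) * ΣS n _ + - 1ℚ * ΣS n _
      ≡⟨ cong₂ (λ u v → (1ℚ + 1ℚ) * u + - 1ℚ * v) (split (single∷ single∷ I)) (split (double∷ I)) ⟩
    (1ℚ + 1ℚ) * ΣS (suc (suc n)) (λ S → c S * weight N (single∷ single∷ I) S)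
      + - 1ℚ * ΣS (suc (suc n)) (λ S → c S * weight N (double∷ I) S)
      ≡⟨ combine-null (1ℚ + 1ℚ) (- 1ℚ) (ann (single∷ single∷ I)) (ann (double∷ I)) ⟩
    0ℚ ∎
    where
    open ≡-Reasoning
    N : ℚ
    N = k + k
    split : ∀ J →
      ΣS n (λ S →
        1ℚ * (1ℚ * (c (false ∷ false ∷ S) * weight N J (false ∷ false ∷ S))
              + 1ℚ * (c (false ∷ true ∷ S) * weight N J (false ∷ true ∷ S)))
        + 1ℚ * (1ℚ * (c (true ∷ false ∷ S) * weight N J (true ∷ false ∷ S))
              + 1ℚ * (c (true ∷ true ∷ S) * weight N J (true ∷ true ∷ S))))
      ≡ ΣS (suc (suc n)) (λ S → c S * weight N J S)
    split J = trans (ΣS-sum n _ _) (cong₂ _+_ (ΣS-sum n _ _) (ΣS-sum n _ _))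

  -- After that replacement, the part in f on `true ∷ S` is a shorter instance of the claim. In the
  -- part in `merge f`, `OddNull` kills every set with a true next bit, which leaves the
  -- coefficients at `false ∷ false ∷ S`, an instance shorter by two.
  annihilator-V : ∀ n (c : Subset n → ℚ) {f : Family n} → Annihilates c → EvenNull n f →
    V (λ x → ΣS n (λ S → c S * f S x))
  annihilator-V zero c {f} ann _ = resp (λ x → sym (lemma (f [] x) {c []} (ann []))) zero∈
    where
    lemma : ∀ a {b} → b * 1ℚ ≡ 0ℚ → b * a ≡ 0ℚ
    lemma a {b} e = trans (cong (_* a) (trans (sym (one b)) e)) (*-zeroˡ a)
      where
      one : ∀ b → b * 1ℚ ≡ b
      one = solve-∀ ℚ-ring
  annihilator-V (suc n) c {f} ann (fT , merged) =
    resp (λ x → trans (sym (ΣS-sum n (λ S → c (false ∷ S) * merge f S x)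
                              (λ S → (c (true ∷ S) + - q * c (false ∷ S)) * f (true ∷ S) x)))
           (trans (ΣS-cong n (λ S → swap-merge q (c (false ∷ S)) (c (true ∷ S))
                                       (f (false ∷ S) x) (f (true ∷ S) x)))
             (ΣS-sum n _ _)))
      (add (merged-V n c ann merged)
           (annihilator-V n (λ S → c (true ∷ S) + - q * c (false ∷ S)) (true-part c ann) fT))
    where
    merged-V : ∀ n (c : Subset (suc n) → ℚ) {g : Family n} → Annihilates c → OddNull n g →
      V (λ x → ΣS n (λ S → c (false ∷ S) * g S x))
    merged-V zero    c ann v = scale (c (false ∷ [])) v
    merged-V (suc n) c ann (gT , gF) = add
      (annihilator-V n (λ S → c (false ∷ false ∷ S)) (false-false-part c ann) gF)
      (ΣS-V n (λ S → c (false ∷ true ∷ S)) gT)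

-- The relations hold for k-Eulerian posets

module Poset (P : GradedPoset) where
  private
    E = Fin (size P)
    els = allFin (size P)

  infix 4 _⊏_
  _⊏_ : E → E → Set
  x ⊏ y = lt P x y ≡ true

  ⊏⇒≤ : ∀ {x y} → x ⊏ y → leq P x y ≡ true
  ⊏⇒≤ {x} {y} h = proj₁ (∧-true {leq P x y} h)

  ⊏-irrefl : ∀ {x y} → x ⊏ y → ¬ x ≡ y
  ⊏-irrefl {x} {y} h e with proj₂ (∧-true {leq P x y} h)
  ... | h′ rewrite ≟-refl x y e with h′
  ... | ()

  ≤∧≢⇒⊏ : ∀ {x y} → leq P x y ≡ true → ¬ x ≡ y → x ⊏ y
  ≤∧≢⇒⊏ {x} {y} l ne = ∧-intro l (cong not (≟-false x y ne))

  ⊏-trans : ∀ {x y z} → x ⊏ y → y ⊏ z → x ⊏ z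
  ⊏-trans {x} {y} {z} xy yz = ≤∧≢⇒⊏ (leq-trans P x y z (⊏⇒≤ xy) (⊏⇒≤ yz)) λ where
    refl → ⊏-irrefl xy (leq-antisym P x y (⊏⇒≤ xy) (⊏⇒≤ yz))

  leq-cases : ∀ {x y} → leq P x y ≡ true → x ≡ y ⊎ x ⊏ y
  leq-cases {x} {y} l = cases (x ≟ y)
    where
    cases : Dec (x ≡ y) → x ≡ y ⊎ x ⊏ y
    cases (yes e) = inj₁ e
    cases (no ne) = inj₂ (≤∧≢⇒⊏ l ne)

  -- The half-open interval (x, y], whose size is the measure for all inductions
  -- on intervals and bounds the fuel that muF needs.
  above : E → E → Subset (size P)
  above x y = tabulate (λ z → lt P x z ∧ leq P z y)

  ∈above : ∀ x y z → z ∈ above x y → x ⊏ z × leq P z y ≡ true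
  ∈above x y z z∈ = ∧-true {lt P x z} (trans (sym (lookup∘tabulate _ z)) ([]=⇒lookup z∈))

  above∋ : ∀ x y z → x ⊏ z → leq P z y ≡ true → z ∈ above x y
  above∋ x y z xz zy = lookup⇒[]= z _ (trans (lookup∘tabulate _ z) (∧-intro xz zy))

  above-shrinks : ∀ {x z y} → x ⊏ z → z ⊏ y → ∣ above x z ∣ < ∣ above x y ∣
  above-shrinks {x} {z} {y} xz zy = p⊂q⇒∣p∣<∣q∣
    ( (λ {w} w∈ → let xw , wz = ∈above x z w w∈ in
        above∋ x y w xw (leq-trans P w z y wz (⊏⇒≤ zy)))
    , y , above∋ x y y (⊏-trans xz zy) (leq-refl P y)
    , (λ y∈ → ⊏-irrefl zy (leq-antisym P z y (⊏⇒≤ zy) (proj₂ (∈above x z y y∈)))) )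

  above-shrinks′ : ∀ {x z y} → x ⊏ z → z ⊏ y → ∣ above z y ∣ < ∣ above x y ∣
  above-shrinks′ {x} {z} {y} xz zy = p⊂q⇒∣p∣<∣q∣
    ( (λ {w} w∈ → let zw , wy = ∈above z y w w∈ in above∋ x y w (⊏-trans xz zw) wy)
    , z , above∋ x y z xz (⊏⇒≤ zy)
    , (λ z∈ → ⊏-irrefl (proj₁ (∈above z y z z∈)) refl) )

  above-nonempty : ∀ {x y} → x ⊏ y → ¬ ∣ above x y ∣ ≤ 0
  above-nonempty {x} {y} xy h = ℕ.n≮0 (ℕ.<-≤-trans
    (p⊂q⇒∣p∣<∣q∣ {p = above y y}
      ( (λ {w} w∈ → let yw , wy = ∈above y y w w∈ in
          above∋ x y w (⊏-trans xy yw) wy)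
      , y , above∋ x y y xy (leq-refl P y)
      , (λ y∈ → ⊏-irrefl (proj₁ (∈above y y y y∈)) refl) )) h)

  -- Ranks are prescribed only on covers. If x < y is not a cover, an element in between splits it
  -- into two smaller intervals.
  rank-mono : ∀ {x y} → x ⊏ y → rank P x < rank P y
  rank-mono {x} {y} = go ∣ above x y ∣ x y ℕ.≤-refl
    where
    go : ∀ m x y → ∣ above x y ∣ ≤ m → x ⊏ y → rank P x < rank P y
    go zero    x y h xy = ⊥-elim (above-nonempty xy h)
    go (suc m) x y h xy with any? (λ z → (lt P x z ∧ lt P z y) ≟ᵇ true)
    ... | yes (z , xzy) = let xz , zy = ∧-true {lt P x z} xzy in ℕ.<-trans
      (go m x z (ℕ.≤-pred (ℕ.≤-trans (above-shrinks xz zy) h)) xz)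
      (go m z y (ℕ.≤-pred (ℕ.≤-trans (above-shrinks′ xz zy) h)) zy)
    ... | no none = ℕ.≤-reflexive (sym (rank-cover P x y xy (λ z → not-true (λ e →
            ⊥-elim (none (z , regroup (leq P x z) (not ⌊ x ≟ z ⌋) _ e))))))
      where
      regroup : ∀ a b c → a ∧ b ∧ c ≡ true → (a ∧ b) ∧ c ≡ true
      regroup true true c e = e

  ε : E → ℚ
  ε x = neg1^ (rank P x)

  ε² : ∀ x → ε x * ε x ≡ 1ℚ
  ε² x = neg1^-square (rank P x)

  neg1^-∸ : ∀ {a b} → a ≤ b → neg1^ (b ∸ a) ≡ neg1^ b * neg1^ a
  neg1^-∸ {zero}  {b}     _         = one (neg1^ b)
    where
    one : ∀ u → u ≡ u * 1ℚ
    one = solve-∀ ℚ-ring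
  neg1^-∸ {suc a} {suc b} (s≤s a≤b) = trans (neg1^-∸ a≤b) (signs (neg1^ b) (neg1^ a))
    where
    signs : ∀ u v → u * v ≡ - u * - v
    signs = solve-∀ ℚ-ring

  rank-sign : ∀ {x y} → leq P x y ≡ true → neg1^ (rank P y ∸ rank P x) ≡ ε y * ε x
  rank-sign {x} {y} l with leq-cases l
  ... | inj₁ refl = neg1^-∸ (ℕ.≤-refl {rank P x})
  ... | inj₂ xy   = neg1^-∸ (ℕ.<⇒≤ (rank-mono xy))

  module Möbius (t : ℕ) where

    mu-unfold : ∀ d x y → x ⊏ y → muF t P (suc d) x y ≡
      - 1ℚ + - (kinv t * Sum els (λ z → when (lt P x z ∧ lt P z y) (muF t P d x z)))
    mu-unfold d x y xy = unfold (⊏-irrefl xy) (⊏⇒≤ xy)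
      where
      unfold : ¬ x ≡ y → leq P x y ≡ true → muF t P (suc d) x y ≡
        - 1ℚ + - (kinv t * Sum els (λ z → when (lt P x z ∧ lt P z y) (muF t P d x z)))
      unfold ne l with x ≟ y
      ... | yes e = ⊥-elim (ne e)
      ... | no _ with leq P x y
      ...   | true = refl

    mu-refl : ∀ d x → muF t P d x x ≡ 1ℚ
    mu-refl d x with x ≟ x
    ... | yes _ = refl
    ... | no ne = ⊥-elim (ne refl)

    -- The recursion passes from y to some z strictly below it, which shrinks (x, y]; so the default
    -- value 0 for exhausted fuel is never reached.
    mu-fuel : ∀ d d′ x y → ∣ above x y ∣ ≤ d → ∣ above x y ∣ ≤ d′ → x ⊏ y →
      muF t P d x y ≡ muF t P d′ x y
    mu-fuel zero    d′       x y h h′ xy = ⊥-elim (above-nonempty xy h)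
    mu-fuel (suc d) zero     x y h h′ xy = ⊥-elim (above-nonempty xy h′)
    mu-fuel (suc d) (suc d′) x y h h′ xy = trans (mu-unfold d x y xy) (trans
      (cong (λ u → - 1ℚ + - (kinv t * u)) (Sum-cong els same))
      (sym (mu-unfold d′ x y xy)))
      where
      same : ∀ z → when (lt P x z ∧ lt P z y) (muF t P d x z) ≡
                   when (lt P x z ∧ lt P z y) (muF t P d′ x z)
      same z with lt P x z in xz | lt P z y in zy
      ... | true  | true  = mu-fuel d d′ x z
                              (ℕ.≤-pred (ℕ.≤-trans (above-shrinks xz zy) h))
                              (ℕ.≤-pred (ℕ.≤-trans (above-shrinks xz zy) h′)) xz
      ... | true  | false = refl
      ... | false | _     = refl

    -- Unfolding consumes a unit of fuel, whereas `muK` has fuel `size P` on both sides; one unit is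
    -- therefore added first.
    mu-rec : ∀ x y → x ⊏ y → muK t P x y ≡
      - 1ℚ + - (kinv t * Sum els (λ z → when (lt P x z ∧ lt P z y) (muK t P x z)))
    mu-rec x y xy = trans
      (mu-fuel (size P) (suc (size P)) x y (∣p∣≤n (above x y)) (ℕ.m≤n⇒m≤1+n (∣p∣≤n (above x y))) xy)
      (mu-unfold (size P) x y xy)

    -- The recursion for μ_k, with μ_k = (-1)^ρ, multiplied by k (-1)^ρ(x).
    Euler : Set
    Euler = ∀ x y → x ⊏ y →
      Sum els (λ z → when (lt P x z ∧ lt P z y) (ε z)) ≡ - (kval t * (ε x + ε y))

    private
      sign-out : ∀ x y (μ : E → ℚ) → (∀ z → x ⊏ z → z ⊏ y → μ z ≡ ε z * ε x) →
        Sum els (λ z → when (lt P x z ∧ lt P z y) (μ z)) ≡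
        ε x * Sum els (λ z → when (lt P x z ∧ lt P z y) (ε z))
      sign-out x y μ h = trans (Sum-cong els same) (Sum-scale els (ε x) _)
        where
        same : ∀ z → when (lt P x z ∧ lt P z y) (μ z) ≡
                     ε x * when (lt P x z ∧ lt P z y) (ε z)
        same z with lt P x z in xz | lt P z y in zy
        ... | true  | true  = trans (h z xz zy) (*-comm (ε z) (ε x))
        ... | true  | false = sym (*-zeroʳ (ε x))
        ... | false | _     = sym (*-zeroʳ (ε x))

      solve-sum : ∀ {k k′ a b s} → k′ * k ≡ 1ℚ → a * a ≡ 1ℚ →
        b * a ≡ - 1ℚ + - (k′ * (a * s)) → s ≡ - (k * (a + b))
      solve-sum {k} {k′} {a} {b} {s} kk aa e =
        trans (identity k k′ a b s) (trans (drop-null _ _ (difference-zero aa))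
          (trans (drop-null _ _ (difference-zero kk)) (drop-null _ _ (difference-zero e))))
        where
        identity : ∀ k k′ a b s → s ≡ - (k * (a + b))
          + (b * a + - (- 1ℚ + - (k′ * (a * s)))) * (k * a)
          + (k′ * k + - 1ℚ) * - (a * a * s) + (a * a + - 1ℚ) * - (k * b + s)
        identity = solve-∀ ℚ-ring

    KEulerian⇒Euler : KEulerian t P → Euler
    KEulerian⇒Euler eul x y xy = solve-sum {kval t} {kinv t} {ε x} {ε y} (kinv*kval t) (ε² x) (trans
      (sym (rank-sign (⊏⇒≤ xy)))
      (trans (sym (eul x y (⊏⇒≤ xy)))
        (trans (mu-rec x y xy) (cong (λ u → - 1ℚ + - (kinv t * u))
          (sign-out x y (muK t P x)
            (λ z xz _ → trans (eul x z (⊏⇒≤ xz)) (rank-sign (⊏⇒≤ xz))))))))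

    -- The recursion determines μ_k, and by `Euler` the signs satisfy it; induction on the size of
    -- the interval.
    Euler⇒KEulerian : Euler → KEulerian t P
    Euler⇒KEulerian eul x y l = trans (go ∣ above x y ∣ x y ℕ.≤-refl l) (sym (rank-sign l))
      where
      expand : ∀ k k′ a b → - 1ℚ + - (k′ * (a * - (k * (a + b)))) ≡ b * a
        + (a * a + - 1ℚ) * 1ℚ + (k′ * k + - 1ℚ) * (a * a + a * b)
      expand = solve-∀ ℚ-ring
      go : ∀ m x y → ∣ above x y ∣ ≤ m → leq P x y ≡ true → muK t P x y ≡ ε y * ε x
      go m x y h l with leq-cases l
      ... | inj₁ refl = trans (mu-refl (size P) x) (sym (ε² x))
      go zero    x y h l | inj₂ xy = ⊥-elim (above-nonempty xy h)
      go (suc m) x y h l | inj₂ xy = begin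
        muK t P x y
          ≡⟨ mu-rec x y xy ⟩
        - 1ℚ + - (kinv t * Sum els (λ z → when (lt P x z ∧ lt P z y) (muK t P x z)))
          ≡⟨ cong (λ u → - 1ℚ + - (kinv t * u)) (sign-out x y (muK t P x) (λ z xz zy →
               go m x z (ℕ.≤-pred (ℕ.≤-trans (above-shrinks xz zy) h)) (⊏⇒≤ xz))) ⟩
        - 1ℚ + - (kinv t * (ε x * Sum els (λ z → when (lt P x z ∧ lt P z y) (ε z))))
          ≡⟨ cong (λ u → - 1ℚ + - (kinv t * (ε x * u))) (eul x y xy) ⟩
        - 1ℚ + - (kinv t * (ε x * - (kval t * (ε x + ε y))))
          ≡⟨ trans (expand (kval t) (kinv t) (ε x) (ε y))
               (trans (drop-null _ _ (difference-zero (kinv*kval t))) (drop-null _ _ (difference-zero (ε² x)))) ⟩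
        ε y * ε x ∎
        where open ≡-Reasoning

-- Chain counts of a k-Eulerian poset, gap by gap

module Chains (P : GradedPoset) where
  private
    E = Fin (size P)
    els = allFin (size P)

  chains : E → List ℕ → ℚ
  chains x rs = fromℕℚ (chainsAbove P x rs)

  fromℕℚ-if : ∀ b m → fromℕℚ (if b then m else 0) ≡ when b (fromℕℚ m)
  fromℕℚ-if true  m = refl
  fromℕℚ-if false m = refl

  chains-∷ : ∀ x r rs →
    chains x (r ∷ rs) ≡ Sum els (λ y → when (lt P x y ∧ (rank P y ≡ᵇ r)) (chains y rs))
  chains-∷ x r rs = trans (fromℕℚ-sum els _)
    (Sum-cong els (λ y → fromℕℚ-if (lt P x y ∧ (rank P y ≡ᵇ r)) (chainsAbove P y rs)))

module Flags (P : GradedPoset) (t : ℕ) (euler : Poset.Möbius.Euler P t) where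
  open Poset P
  open Chains P
  open Systems ℚ-zero (kval t) (negInv2k t) (negInv2k*2kval t)
  private
    E = Fin (size P)
    els = allFin (size P)
    k = kval t

  from : ∀ {n} → E → ℕ → Family n
  from x p T _ = chains x (ranksFrom (suc p) T)

  -- The partial sum `s` of `Eqs` for the gap that starts just above x: one signed term for each z
  -- above x of rank at most p, the ranks read so far.
  gap : ∀ {n} → E → ℕ → Family n
  gap x p T _ = Sum els (λ z → when (lt P x z ∧ (rank P z ≤ᵇ p)) (ε z * from z p T tt))

  -- Guarded so as to hold for every pair: if x is not below y, both terms vanish. It can then be
  -- summed over all y.
  euler-at : ∀ x y (c : ℚ) → when (lt P x y) (k * (ε x + ε y) * c)
    + Sum els (λ z → when (lt P x z) (ε z * when (lt P z y) c)) ≡ 0ℚ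
  euler-at x y c with lt P x y in xy
  ... | false = trans (+-identityˡ _) (Sum-zero els none)
    where
    none : ∀ z → when (lt P x z) (ε z * when (lt P z y) c) ≡ 0ℚ
    none z with lt P x z in xz | lt P z y in zy
    ... | true  | true  = ⊥-elim (true≢false (⊏-trans xz zy) xy)
    ... | true  | false = *-zeroʳ (ε z)
    ... | false | _     = refl
  ... | true  = trans (cong (k * (ε x + ε y) * c +_) (trans (Sum-cong els pull)
                  (trans (Sum-scale els c _) (cong (c *_) (euler x y xy)))))
                (opposite k (ε x) (ε y) c)
    where
    pull : ∀ z → when (lt P x z) (ε z * when (lt P z y) c) ≡
                 c * when (lt P x z ∧ lt P z y) (ε z)
    pull z with lt P x z | lt P z y
    ... | true  | true  = *-comm (ε z) c
    ... | true  | false = trans (*-zeroʳ (ε z)) (sym (*-zeroʳ c))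
    ... | false | _     = sym (*-zeroʳ c)
    opposite : ∀ k a b c → k * (a + b) * c + c * - (k * (a + b)) ≡ 0ℚ
    opposite = solve-∀ ℚ-ring

  Sum-when : ∀ b (g : E → ℚ) → when b (Sum els g) ≡ Sum els (λ y → when b (g y))
  Sum-when true  g = refl
  Sum-when false g = sym (Sum-zero els (λ _ → refl))

  when-off : ∀ b {b′} → b′ ≡ false → ∀ c → when (b ∧ b′) c ≡ 0ℚ
  when-off true  refl c = refl
  when-off false refl c = refl

  when-on : ∀ b {b′} → b′ ≡ true → ∀ c → when (b ∧ b′) c ≡ when b c
  when-on true  refl c = refl
  when-on false refl c = refl

  when-guard : ∀ b b′ b″ u c → (b′ ≡ true → b″ ≡ true) →
    when (b ∧ b″) (u * when b′ c) ≡ when b (u * when b′ c)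
  when-guard false b′    b″    u c h = refl
  when-guard true  b′    true  u c h = refl
  when-guard true  false false u c h = sym (*-zeroʳ u)
  when-guard true  true  false u c h = ⊥-elim (true≢false (h refl) refl)

  -- Both terms are sums over the element y of rank p+1 that closes the gap. After exchanging the
  -- sums, each y contributes the Euler relation of [x,y]: its sign is -(-1)^p, and any z below y
  -- has rank at most p.
  close-gap : ∀ {n} x p (T : Subset n) →
    closing (ε x) (neg1^ p) (from x p) (gap x p) (true ∷ T) tt ≡ 0ℚ
  close-gap x p T = begin
    c * chains x (suc p ∷ rs) + Sum els (λ z → when (lt P x z ∧ (rank P z ≤ᵇ p)) (ε z * chains z (suc p ∷ rs)))
      ≡⟨ cong₂ (λ u v → c * u + v) (chains-∷ x (suc p) rs) (Sum-cong els spread) ⟩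
    c * Sum els (λ y → at x y) + Sum els (λ z → Sum els (λ y → when (lt P x z ∧ (rank P z ≤ᵇ p)) (ε z * at z y)))
      ≡⟨ cong₂ _+_ (sym (Sum-scale els c (at x))) (Sum-swap els els _) ⟩
    Sum els (λ y → c * at x y) + Sum els (λ y → Sum els (λ z → when (lt P x z ∧ (rank P z ≤ᵇ p)) (ε z * at z y)))
      ≡⟨ sym (Sum-add els _ _) ⟩
    Sum els (λ y → c * at x y + Sum els (λ z → when (lt P x z ∧ (rank P z ≤ᵇ p)) (ε z * at z y)))
      ≡⟨ Sum-zero els each ⟩
    0ℚ ∎
    where
    open ≡-Reasoning
    rs = ranksFrom (suc (suc p)) T
    c = k * (ε x + - neg1^ p)
    at : E → E → ℚ
    at z y = when (lt P z y ∧ (rank P y ≡ᵇ suc p)) (chains y rs)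
    spread : ∀ z → when (lt P x z ∧ (rank P z ≤ᵇ p)) (ε z * chains z (suc p ∷ rs)) ≡
      Sum els (λ y → when (lt P x z ∧ (rank P z ≤ᵇ p)) (ε z * at z y))
    spread z = trans
      (cong (λ u → when (lt P x z ∧ (rank P z ≤ᵇ p)) u)
        (trans (cong (ε z *_) (chains-∷ z (suc p) rs)) (sym (Sum-scale els (ε z) (at z)))))
      (Sum-when (lt P x z ∧ (rank P z ≤ᵇ p)) _)
    each : ∀ y → c * at x y + Sum els (λ z → when (lt P x z ∧ (rank P z ≤ᵇ p)) (ε z * at z y)) ≡ 0ℚ
    each y = by-rank (rank P y ℕ.≟ suc p)
      where
      by-rank : Dec (rank P y ≡ suc p) →
        c * at x y + Sum els (λ z → when (lt P x z ∧ (rank P z ≤ᵇ p)) (ε z * at z y)) ≡ 0ℚ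
      by-rank (no ne) = trans (cong₂ _+_
          (trans (cong (c *_) (off x)) (*-zeroʳ c))
          (Sum-zero els (λ z → trans
            (cong (λ u → when (lt P x z ∧ (rank P z ≤ᵇ p)) (ε z * u)) (off z))
            (null (lt P x z ∧ (rank P z ≤ᵇ p)) (ε z)))))
          refl
        where
        off : ∀ z → at z y ≡ 0ℚ
        off z = when-off (lt P z y) (≡ᵇ-false ne) (chains y rs)
        null : ∀ b u → when b (u * 0ℚ) ≡ 0ℚ
        null true  u = *-zeroʳ u
        null false u = refl
      by-rank (yes e) = trans (cong₂ _+_ first (Sum-cong els rest)) (euler-at x y (chains y rs))
        where
        on : ∀ z → at z y ≡ when (lt P z y) (chains y rs)
        on z = when-on (lt P z y) (≡ᵇ-true e) (chains y rs)
        scale-when : ∀ b a u → a * when b u ≡ when b (a * u)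
        scale-when true  a u = refl
        scale-when false a u = *-zeroʳ a
        first : c * at x y ≡ when (lt P x y) (k * (ε x + ε y) * chains y rs)
        first = trans (cong (c *_) (on x)) (trans
          (cong (λ u → k * (ε x + u) * when (lt P x y) (chains y rs)) (sym (cong neg1^ e)))
          (scale-when (lt P x y) (k * (ε x + ε y)) (chains y rs)))
        rest : ∀ z → when (lt P x z ∧ (rank P z ≤ᵇ p)) (ε z * at z y) ≡
                     when (lt P x z) (ε z * when (lt P z y) (chains y rs))
        rest z = trans (cong (λ u → when (lt P x z ∧ (rank P z ≤ᵇ p)) (ε z * u)) (on z))
          (when-guard (lt P x z) (lt P z y) (rank P z ≤ᵇ p) (ε z) (chains y rs)
            (λ zy → ≤ᵇ-true (ℕ.≤-pred (subst (rank P z <_) e (rank-mono zy)))))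

  -- The last gap is closed by the maximum, which takes the part of y.
  close-top : ∀ x p → rank P x ≤ p → suc p ≡ rankP P →
    closing (ε x) (neg1^ p) (from {0} x p) (gap x p) [] tt ≡ 0ℚ
  close-top x p x≤p e = trans
    (cong₂ (λ u v → k * (ε x + u) * 1ℚ + v) (cong neg1^ e)
      (trans (Sum-cong els same) (euler x (top P) x⊏top)))
    (opposite k (ε x) (ε (top P)))
    where
    opposite : ∀ k a b → k * (a + b) * 1ℚ + - (k * (a + b)) ≡ 0ℚ
    opposite = solve-∀ ℚ-ring
    below-top : ∀ z → rank P z ≤ p → z ⊏ top P
    below-top z z≤p = ≤∧≢⇒⊏ (top-max P z) λ where
      refl → ℕ.<-irrefl (sym e) (s≤s z≤p)
    x⊏top : x ⊏ top P
    x⊏top = below-top x x≤p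
    same : ∀ z → when (lt P x z ∧ (rank P z ≤ᵇ p)) (ε z * 1ℚ) ≡
                 when (lt P x z ∧ lt P z (top P)) (ε z)
    same z = cong₂ (λ b → when (lt P x z ∧ b))
      (Bool-iff {rank P z ≤ᵇ p} (λ h → below-top z (≤ᵇ-true⁻¹ h))
        (λ h → ≤ᵇ-true (ℕ.≤-pred (subst (rank P z <_) (sym e) (rank-mono h)))))
      (*-identityʳ (ε z))

  when-extend : ∀ b r p c → when (b ∧ (r ≤ᵇ p)) (neg1^ r * c)
    + - neg1^ p * when (b ∧ (r ≡ᵇ suc p)) c ≡ when (b ∧ (r ≤ᵇ suc p)) (neg1^ r * c)
  when-extend false r p c = trans (+-identityˡ _) (*-zeroʳ (- neg1^ p))
  when-extend true  r p c = by-order (ℕ.<-cmp r (suc p))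
    where
    add-zero : ∀ u a → u + a * 0ℚ ≡ u
    add-zero = solve-∀ ℚ-ring
    by-order : Tri (r < suc p) (r ≡ suc p) (suc p < r) →
      when (r ≤ᵇ p) (neg1^ r * c) + - neg1^ p * when (r ≡ᵇ suc p) c
      ≡ when (r ≤ᵇ suc p) (neg1^ r * c)
    by-order (tri< l ne _)
      rewrite ≤ᵇ-true (ℕ.≤-pred l) | ≡ᵇ-false ne | ≤ᵇ-true (ℕ.<⇒≤ l) =
      add-zero (neg1^ r * c) (- neg1^ p)
    by-order (tri≈ _ e _)
      rewrite ≤ᵇ-false {r} {p} (ℕ.≤-reflexive (sym e)) | ≡ᵇ-true e
            | ≤ᵇ-true (ℕ.≤-reflexive e) =
      trans (+-identityˡ _) (cong (_* c) (sym (cong neg1^ e)))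
    by-order (tri> _ ne g)
      rewrite ≤ᵇ-false {r} {p} (ℕ.<⇒≤ g) | ≡ᵇ-false ne | ≤ᵇ-false g = add-zero 0ℚ (- neg1^ p)

  gap-extend : ∀ {n} x p (T : Subset n) →
    extend (neg1^ p) (from x p) (gap x p) T tt ≡ gap x (suc p) T tt
  gap-extend x p T = begin
    gap x p (false ∷ T) tt + - neg1^ p * chains x (suc p ∷ rs)
      ≡⟨ cong (λ u → gap x p (false ∷ T) tt + - neg1^ p * u) (chains-∷ x (suc p) rs) ⟩
    gap x p (false ∷ T) tt + - neg1^ p * Sum els (λ z → when (lt P x z ∧ (rank P z ≡ᵇ suc p)) (chains z rs))
      ≡⟨ cong (gap x p (false ∷ T) tt +_) (sym (Sum-scale els (- neg1^ p) _)) ⟩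
    gap x p (false ∷ T) tt + Sum els (λ z → - neg1^ p * when (lt P x z ∧ (rank P z ≡ᵇ suc p)) (chains z rs))
      ≡⟨ sym (Sum-add els _ _) ⟩
    Sum els (λ z → when (lt P x z ∧ (rank P z ≤ᵇ p)) (ε z * chains z rs)
                   + - neg1^ p * when (lt P x z ∧ (rank P z ≡ᵇ suc p)) (chains z rs))
      ≡⟨ Sum-cong els each ⟩
    gap x (suc p) T tt ∎
    where
    open ≡-Reasoning
    rs = ranksFrom (suc (suc p)) T
    each : ∀ z → when (lt P x z ∧ (rank P z ≤ᵇ p)) (ε z * chains z rs)
        + - neg1^ p * when (lt P x z ∧ (rank P z ≡ᵇ suc p)) (chains z rs)
      ≡ when (lt P x z ∧ (rank P z ≤ᵇ suc p)) (ε z * chains z rs)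
    each z = when-extend (lt P x z) (rank P z) p (chains z rs)

  when-absurd : ∀ b b′ c → (b ≡ true → b′ ≡ false) → when (b ∧ b′) c ≡ 0ℚ
  when-absurd true  true  c h = ⊥-elim (true≢false refl (h refl))
  when-absurd true  false c h = refl
  when-absurd false b′    c h = refl

  gap-empty : ∀ {n} y p → rank P y ≡ p → (T : Subset n) → gap y p T tt ≡ 0ℚ
  gap-empty y p y≡ T = Sum-zero els (λ z →
    when-absurd (lt P y z) (rank P z ≤ᵇ p) (ε z * from z p T tt)
      (λ yz → ≤ᵇ-false (subst (_< rank P z) y≡ (rank-mono yz))))

  -- Stated for chains that continue from any x with p ranks read, where x is the last chosen
  -- element and the open gap consists of the ranks from ρ(x)+1 to p.
  flag-Eqs : ∀ n x p → rank P x ≤ p → n +ℕ suc p ≡ rankP P →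
    Eqs (ε x) (neg1^ p) n (from x p) (gap x p)
  flag-Eqs zero    x p x≤p e = close-top x p x≤p e
  flag-Eqs (suc n) x p x≤p e =
    (λ T → close-gap x p T) ,
    Eqs-resp n
      (Eqs-sum n els {f = λ y T _ → when (lt P x y ∧ (rank P y ≡ᵇ suc p)) (from y (suc p) T tt)}
        restart)
      (λ T _ → chains-∷ x (suc p) (ranksFrom (suc (suc p)) T)) (λ _ _ → refl) ,
    Eqs-resp n (flag-Eqs n x (suc p) (ℕ.m≤n⇒m≤1+n x≤p) e′) (λ _ _ → refl)
      (λ T _ → gap-extend x p T)
    where
    e′ : n +ℕ suc (suc p) ≡ rankP P
    e′ = trans (ℕ.+-suc n (suc p)) e
    -- Chains that use rank p+1 are sorted by their element y there. From y on the gap is empty; for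
    -- all other y the guard makes the family zero.
    restart : ∀ y → Eqs (neg1^ (suc p)) (neg1^ (suc p)) n
      (λ T _ → when (lt P x y ∧ (rank P y ≡ᵇ suc p)) (from y (suc p) T tt)) (λ _ _ → 0ℚ)
    restart y = guarded (lt P x y) (rank P y ≡ᵇ suc p) (λ ey →
      let y≡ = ℕ.≡ᵇ⇒≡ _ _ (Equivalence.from T-≡ ey) in Eqs-resp n
        (subst (λ σ → Eqs σ (neg1^ (suc p)) n (from y (suc p)) (gap y (suc p)))
          (cong neg1^ y≡) (flag-Eqs n y (suc p) (ℕ.≤-reflexive y≡) e′))
        (λ _ _ → refl) (λ T _ → sym (gap-empty y (suc p) y≡ T)))
      where
      guarded : ∀ b b′ {σ} {f : Family n} → (b′ ≡ true → Eqs σ σ n f (λ _ _ → 0ℚ)) →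
        Eqs σ σ n (λ T x → when (b ∧ b′) (f T x)) (λ _ _ → 0ℚ)
      guarded true  true  h = h refl
      guarded true  false h = Eqs-zero n
      guarded false b′    h = Eqs-zero n

  flagVec-Eqs : ∀ n → rankP P ≡ suc n →
    Eqs 1ℚ 1ℚ n (λ S _ → flagVec P n S) (λ _ _ → 0ℚ)
  flagVec-Eqs n e = Eqs-resp n
    (subst (λ σ → Eqs σ 1ℚ n (from (bot P) 0) (gap (bot P) 0)) (cong neg1^ (rank-bot P))
      (flag-Eqs n (bot P) 0 (ℕ.≤-reflexive (rank-bot P)) (trans (ℕ.+-comm n 1) (sym e))))
    (λ _ _ → refl) (λ T _ → sym (gap-empty (bot P) 0 (rank-bot P) T))

-- Enough k-Eulerian posets

-- Elements of the ordinal sum of the blocks of I and a top element, up to the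
-- multiplicity of the elements of the antichains.
data Elt : ∀ {n} → Word n → Set where
  peak     : Elt []
  here    : ∀ {n} {I : Word n} → Elt (single∷ I)
  skip    : ∀ {n} {I : Word n} → Elt I → Elt (single∷ I)
  low upp : ∀ {n} {I : Word n} → Bool → Elt (double∷ I)
  skip₂   : ∀ {n} {I : Word n} → Elt I → Elt (double∷ I)

private variable
  I : Word n

below : Elt I → Elt I → Bool
below peak       peak       = false
below here      here      = false
below here      (skip _)  = true
below (skip _)  here      = false
below (skip a)  (skip b)  = below a b
below (low _)   (low _)   = false
below (low c)   (upp d)   = not (c xor d)
below (low _)   (skip₂ _) = true
below (upp _)   (low _)   = false
below (upp _)   (upp _)   = false
below (upp _)   (skip₂ _) = true
below (skip₂ _) (low _)   = false
below (skip₂ _) (upp _)   = false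
below (skip₂ a) (skip₂ b) = below a b

height : Elt I → ℕ
height peak       = 0
height here      = 0
height (skip a)  = suc (height a)
height (low _)   = 0
height (upp _)   = 1
height (skip₂ a) = suc (suc (height a))

topElt : (I : Word n) → Elt I
topElt []          = peak
topElt (single∷ I) = skip (topElt I)
topElt (double∷ I) = skip₂ (topElt I)

height-top : (I : Word n) → height (topElt I) ≡ n
height-top []          = refl
height-top (single∷ I) = cong suc (height-top I)
height-top (double∷ I) = cong (λ h → suc (suc h)) (height-top I)

below-irrefl : (a : Elt I) → below a a ≡ false
below-irrefl peak         = refl
below-irrefl here        = refl
below-irrefl (skip a)    = below-irrefl a
below-irrefl (low _)     = refl
below-irrefl (upp _)     = refl
below-irrefl (skip₂ a)   = below-irrefl a

below-trans : (a b c : Elt I) → below a b ≡ true → below b c ≡ true → below a c ≡ true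
below-trans peak       peak       _         ()
below-trans here      here      _         ()
below-trans here      (skip b)  here      _ ()
below-trans here      (skip b)  (skip c)  _ _ = refl
below-trans (skip a)  here      _         ()
below-trans (skip a)  (skip b)  here      _ ()
below-trans (skip a)  (skip b)  (skip c)  p q = below-trans a b c p q
below-trans (low _)   (low _)   _         ()
below-trans (low _)   (upp _)   (low _)   _ ()
below-trans (low _)   (upp _)   (upp _)   _ ()
below-trans (low _)   (upp _)   (skip₂ _) _ _ = refl
below-trans (low _)   (skip₂ _) (low _)   _ ()
below-trans (low _)   (skip₂ _) (upp _)   _ ()
below-trans (low _)   (skip₂ _) (skip₂ _) _ _ = refl
below-trans (upp _)   (low _)   _         ()
below-trans (upp _)   (upp _)   _         ()
below-trans (upp _)   (skip₂ _) (low _)   _ ()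
below-trans (upp _)   (skip₂ _) (upp _)   _ ()
below-trans (upp _)   (skip₂ _) (skip₂ _) _ _ = refl
below-trans (skip₂ _) (low _)   _         ()
below-trans (skip₂ _) (upp _)   _         ()
below-trans (skip₂ _) (skip₂ _) (low _)   _ ()
below-trans (skip₂ _) (skip₂ _) (upp _)   _ ()
below-trans (skip₂ a) (skip₂ b) (skip₂ c) p q = below-trans a b c p q

same-component : (I : Word n) → ∀ c → below {I = double∷ I} (low c) (upp c) ≡ true
same-component I true  = refl
same-component I false = refl

minimal-below : (b : Elt I) → height b ≡ 0 ⊎ ∃[ a ] below a b ≡ true
minimal-below peak       = inj₁ refl
minimal-below here      = inj₁ refl
minimal-below (skip b)  = inj₂ (here , refl)
minimal-below (low c)   = inj₁ refl
minimal-below {I = double∷ I} (upp c) = inj₂ (low c , same-component I c)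
minimal-below (skip₂ b) = inj₂ (low false , refl)

-- The positive form of gradedness: in `rank-cover` the second alternative is refuted by the
-- hypothesis, which leaves the first.
cover-or-between : (a b : Elt I) → below a b ≡ true →
  height b ≡ suc (height a) ⊎ ∃[ c ] below a c ≡ true × below c b ≡ true
cover-or-between peak  peak      ()
cover-or-between here here     ()
cover-or-between here (skip b) _ with minimal-below b
... | inj₁ h       = inj₁ (cong suc h)
... | inj₂ (c , l) = inj₂ (skip c , refl , l)
cover-or-between (skip a) here ()
cover-or-between (skip a) (skip b) l with cover-or-between a b l
... | inj₁ h            = inj₁ (cong suc h)
... | inj₂ (c , l , l′) = inj₂ (skip c , l , l′)
cover-or-between (low _) (low _) ()
cover-or-between (low c) (upp d) _ = inj₁ refl
cover-or-between {I = double∷ I} (low c) (skip₂ b) _ = inj₂ (upp c , same-component I c , refl)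
cover-or-between (upp _) (low _) ()
cover-or-between (upp _) (upp _) ()
cover-or-between (upp c) (skip₂ b) _ with minimal-below b
... | inj₁ h       = inj₁ (cong (λ h → suc (suc h)) h)
... | inj₂ (c , l) = inj₂ (skip₂ c , refl , l)
cover-or-between (skip₂ _) (low _) ()
cover-or-between (skip₂ _) (upp _) ()
cover-or-between (skip₂ a) (skip₂ b) l with cover-or-between a b l
... | inj₁ h            = inj₁ (cong (λ h → suc (suc h)) h)
... | inj₂ (c , l , l′) = inj₂ (skip₂ c , l , l′)

-- Weighted sums and chain counts over the elements of a word

module Weighted (N : ℚ) where

  -- Every element but the top one counts N times.
  All : (I : Word n) → (Elt I → ℚ) → ℚ
  All []          g = g peak
  All (single∷ I) g = N * g here + All I (g ∘ skip)
  All (double∷ I) g = N * g (low false) + N * g (low true) +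
                      (N * g (upp false) + N * g (upp true)) + All I (g ∘ skip₂)

  private
    add₅ : ∀ {a a′ b b′ c c′ d d′ e e′ : ℚ} → a ≡ a′ → b ≡ b′ → c ≡ c′ → d ≡ d′ → e ≡ e′ →
      N * a + N * b + (N * c + N * d) + e ≡ N * a′ + N * b′ + (N * c′ + N * d′) + e′
    add₅ refl refl refl refl refl = refl

  All-cong : (I : Word n) {g h : Elt I → ℚ} → (∀ a → g a ≡ h a) → All I g ≡ All I h
  All-cong []          e = e peak
  All-cong (single∷ I) e = cong₂ (λ u v → N * u + v) (e here) (All-cong I (e ∘ skip))
  All-cong (double∷ I) e = add₅ (e (low false)) (e (low true)) (e (upp false)) (e (upp true))
    (All-cong I (e ∘ skip₂))

  All-zero : (I : Word n) {g : Elt I → ℚ} → (∀ a → g a ≡ 0ℚ) → All I g ≡ 0ℚ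
  All-zero []          e = e peak
  All-zero (single∷ I) e = trans (cong₂ (λ u v → N * u + v) (e here) (All-zero I (e ∘ skip)))
    (zeros N)
    where
    zeros : ∀ N → N * 0ℚ + 0ℚ ≡ 0ℚ
    zeros = solve-∀ ℚ-ring
  All-zero (double∷ I) e = trans
    (add₅ (e (low false)) (e (low true)) (e (upp false)) (e (upp true)) (All-zero I (e ∘ skip₂)))
    (zeros N)
    where
    zeros : ∀ N → N * 0ℚ + N * 0ℚ + (N * 0ℚ + N * 0ℚ) + 0ℚ ≡ 0ℚ
    zeros = solve-∀ ℚ-ring

  All-neg : (I : Word n) (g : Elt I → ℚ) → All I (λ a → - g a) ≡ - All I g
  All-neg []          g = refl
  All-neg (single∷ I) g = trans (cong (N * - g here +_) (All-neg I (g ∘ skip)))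
    (negs N (g here) (All I (g ∘ skip)))
    where
    negs : ∀ N a b → N * - a + - b ≡ - (N * a + b)
    negs = solve-∀ ℚ-ring
  All-neg (double∷ I) g = trans (add₅ refl refl refl refl (All-neg I (g ∘ skip₂)))
    (negs N (g (low false)) (g (low true)) (g (upp false)) (g (upp true)) (All I (g ∘ skip₂)))
    where
    negs : ∀ N a b c d e → N * - a + N * - b + (N * - c + N * - d) + - e
      ≡ - (N * a + N * b + (N * c + N * d) + e)
    negs = solve-∀ ℚ-ring

  sign : Elt I → ℚ
  sign a = neg1^ (height a)

  down : (b : Elt I) → Elt I → ℚ
  down b a = when (below a b) (sign a)

  between : (a b : Elt I) → Elt I → ℚ
  between a b c = when (below a c ∧ below c b) (sign c)

  private
    when-neg : ∀ b u → when b (- u) ≡ - when b u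
    when-neg true  u = refl
    when-neg false u = refl

    when-neg² : ∀ b u → when b (- - u) ≡ when b u
    when-neg² true  u = neg² u
      where
      neg² : ∀ u → - - u ≡ u
      neg² = solve-∀ ℚ-ring
    when-neg² false u = refl

    ∧-false : ∀ b u → when (b ∧ false) u ≡ 0ℚ
    ∧-false true  u = refl
    ∧-false false u = refl

  down-skip : (b : Elt I) → All I (λ a → when (below a b) (- sign a)) ≡ - All I (down b)
  down-skip {I = I} b = trans (All-cong I (λ a → when-neg (below a b) (sign a))) (All-neg I (down b))

  down-skip₂ : (b : Elt I) → All I (λ a → when (below a b) (- - sign a)) ≡ All I (down b)
  down-skip₂ {I = I} b = All-cong I (λ a → when-neg² (below a b) (sign a))

  two : ℚ
  two = 1ℚ + 1ℚ

  -- Below b, whole `single` blocks contribute N with alternating sign when no `double` block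
  -- intervenes, and a `double` block contributes 2N - 2N = 0 while keeping the sign. The total is N
  -- or 0 according to the parity of the height.
  All-down : (b : Elt I) → two * All I (down b) ≡ N * (1ℚ + - sign b)
  All-down peak = zeros N
    where
    zeros : ∀ N → (1ℚ + 1ℚ) * 0ℚ ≡ N * (1ℚ + - 1ℚ)
    zeros = solve-∀ ℚ-ring
  All-down {I = single∷ I} here = trans
    (cong (λ u → two * (N * 0ℚ + u)) (All-zero I (λ _ → refl))) (zeros N)
    where
    zeros : ∀ N → (1ℚ + 1ℚ) * (N * 0ℚ + 0ℚ) ≡ N * (1ℚ + - 1ℚ)
    zeros = solve-∀ ℚ-ring
  All-down {I = single∷ I} (skip b) = begin
    two * (N * 1ℚ + All I (λ a → when (below a b) (- sign a)))
      ≡⟨ cong (λ u → two * (N * 1ℚ + u)) (down-skip b) ⟩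
    two * (N * 1ℚ + - All I (down b))
      ≡⟨ expand N (All I (down b)) ⟩
    two * N + - (two * All I (down b))
      ≡⟨ cong (λ u → two * N + - u) (All-down b) ⟩
    two * N + - (N * (1ℚ + - sign b))
      ≡⟨ collect N (sign b) ⟩
    N * (1ℚ + - - sign b) ∎
    where
    open ≡-Reasoning
    expand : ∀ N s → (1ℚ + 1ℚ) * (N * 1ℚ + - s) ≡ (1ℚ + 1ℚ) * N + - ((1ℚ + 1ℚ) * s)
    expand = solve-∀ ℚ-ring
    collect : ∀ N s → (1ℚ + 1ℚ) * N + - (N * (1ℚ + - s)) ≡ N * (1ℚ + - - s)
    collect = solve-∀ ℚ-ring
  All-down {I = double∷ I} (low c) = trans
    (cong (λ u → two * (N * 0ℚ + N * 0ℚ + (N * 0ℚ + N * 0ℚ) + u)) (All-zero I (λ _ → refl))) (zeros N)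
    where
    zeros : ∀ N → (1ℚ + 1ℚ) * (N * 0ℚ + N * 0ℚ + (N * 0ℚ + N * 0ℚ) + 0ℚ) ≡ N * (1ℚ + - 1ℚ)
    zeros = solve-∀ ℚ-ring
  All-down {I = double∷ I} (upp false) = trans
    (cong (λ u → two * (N * 1ℚ + N * 0ℚ + (N * 0ℚ + N * 0ℚ) + u)) (All-zero I (λ _ → refl))) (one N)
    where
    one : ∀ N → (1ℚ + 1ℚ) * (N * 1ℚ + N * 0ℚ + (N * 0ℚ + N * 0ℚ) + 0ℚ) ≡ N * (1ℚ + - - 1ℚ)
    one = solve-∀ ℚ-ring
  All-down {I = double∷ I} (upp true) = trans
    (cong (λ u → two * (N * 0ℚ + N * 1ℚ + (N * 0ℚ + N * 0ℚ) + u)) (All-zero I (λ _ → refl))) (one N)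
    where
    one : ∀ N → (1ℚ + 1ℚ) * (N * 0ℚ + N * 1ℚ + (N * 0ℚ + N * 0ℚ) + 0ℚ) ≡ N * (1ℚ + - - 1ℚ)
    one = solve-∀ ℚ-ring
  All-down {I = double∷ I} (skip₂ b) = trans
    (cong (λ u → two * (N * 1ℚ + N * 1ℚ + (N * - 1ℚ + N * - 1ℚ) + u)) (down-skip₂ b))
    (trans (cancel N (All I (down b))) (trans (All-down b) (neg² N (sign b))))
    where
    cancel : ∀ N s → (1ℚ + 1ℚ) * (N * 1ℚ + N * 1ℚ + (N * - 1ℚ + N * - 1ℚ) + s) ≡ (1ℚ + 1ℚ) * s
    cancel = solve-∀ ℚ-ring
    neg² : ∀ N s → N * (1ℚ + - s) ≡ N * (1ℚ + - - - s)
    neg² = solve-∀ ℚ-ring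

  All-between-skip : (a b : Elt I) →
    two * All I (between a b) ≡ - (N * (sign a + sign b)) →
    two * All I (λ c → when (below a c ∧ below c b) (- sign c)) ≡ - (N * (- sign a + - sign b))
  All-between-skip {I = I} a b IH = begin
    two * All I (λ c → when (below a c ∧ below c b) (- sign c))
      ≡⟨ cong (two *_) (trans (All-cong I (λ c → when-neg (below a c ∧ below c b) (sign c)))
           (All-neg I (between a b))) ⟩
    two * - All I (between a b)
      ≡⟨ out (All I (between a b)) ⟩
    - (two * All I (between a b))
      ≡⟨ cong -_ IH ⟩
    - - (N * (sign a + sign b))
      ≡⟨ neg N (sign a) (sign b) ⟩
    - (N * (- sign a + - sign b)) ∎
    where
    open ≡-Reasoning
    out : ∀ s → (1ℚ + 1ℚ) * - s ≡ - ((1ℚ + 1ℚ) * s)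
    out = solve-∀ ℚ-ring
    neg : ∀ N a b → - - (N * (a + b)) ≡ - (N * (- a + - b))
    neg = solve-∀ ℚ-ring

  All-above-here : (b : Elt I) →
    two * All I (λ c → when (below c b) (- sign c)) ≡ - (N * (1ℚ + - sign b))
  All-above-here {I = I} b = trans (cong (two *_) (down-skip b))
    (trans (out (All I (down b))) (cong -_ (All-down b)))
    where
    out : ∀ s → (1ℚ + 1ℚ) * - s ≡ - ((1ℚ + 1ℚ) * s)
    out = solve-∀ ℚ-ring

  -- The Euler relation for k = N/2, doubled to avoid the fraction. Above the block of a, the
  -- interval is counted by `All-down`; inside it only a lower element of a `double` block sees
  -- anything, namely the N upper elements of its own copy, which contribute -N.
  All-between : (a b : Elt I) → below a b ≡ true →
    two * All I (between a b) ≡ - (N * (sign a + sign b))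
  All-between peak  peak  ()
  All-between here here ()
  All-between {I = single∷ I} here (skip b) _ =
    trans (drop N (All I (λ c → when (below c b) (- sign c)))) (All-above-here b)
    where
    drop : ∀ N s → (1ℚ + 1ℚ) * (N * 0ℚ + s) ≡ (1ℚ + 1ℚ) * s
    drop = solve-∀ ℚ-ring
  All-between (skip a) here ()
  All-between {I = single∷ I} (skip a) (skip b) l =
    trans (drop N (All I (λ c → when (below a c ∧ below c b) (- sign c))))
      (All-between-skip a b (All-between a b l))
    where
    drop : ∀ N s → (1ℚ + 1ℚ) * (N * 0ℚ + s) ≡ (1ℚ + 1ℚ) * s
    drop = solve-∀ ℚ-ring
  All-between (low _) (low _) ()
  All-between {I = double∷ I} (low c) (upp d) _ = trans
    (cong (two *_) (All-zero (double∷ I) nothing)) (zeros N)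
    where
    nothing : ∀ a → between {I = double∷ I} (low c) (upp d) a ≡ 0ℚ
    nothing (low _)   = refl
    nothing (upp e)   = ∧-false (below {I = double∷ I} (low c) (upp e)) _
    nothing (skip₂ _) = refl
    zeros : ∀ N → (1ℚ + 1ℚ) * 0ℚ ≡ - (N * (1ℚ + - 1ℚ))
    zeros = solve-∀ ℚ-ring
  All-between {I = double∷ I} (low c) (skip₂ b) _ = begin
    two * All (double∷ I) (between (low c) (skip₂ b))
      ≡⟨ cong (two *_) (only c) ⟩
    two * (N * - 1ℚ + All I (down b))
      ≡⟨ expand N (All I (down b)) ⟩
    - (two * N) + two * All I (down b)
      ≡⟨ cong (- (two * N) +_) (All-down b) ⟩
    - (two * N) + N * (1ℚ + - sign b)
      ≡⟨ collect N (sign b) ⟩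
    - (N * (1ℚ + - - sign b)) ∎
    where
    open ≡-Reasoning
    expand : ∀ N s → (1ℚ + 1ℚ) * (N * - 1ℚ + s) ≡ - ((1ℚ + 1ℚ) * N) + (1ℚ + 1ℚ) * s
    expand = solve-∀ ℚ-ring
    collect : ∀ N s → - ((1ℚ + 1ℚ) * N) + N * (1ℚ + - s) ≡ - (N * (1ℚ + - - s))
    collect = solve-∀ ℚ-ring
    left : ∀ N s → N * 0ℚ + N * 0ℚ + (N * - 1ℚ + N * 0ℚ) + s ≡ N * - 1ℚ + s
    left = solve-∀ ℚ-ring
    right : ∀ N s → N * 0ℚ + N * 0ℚ + (N * 0ℚ + N * - 1ℚ) + s ≡ N * - 1ℚ + s
    right = solve-∀ ℚ-ring
    only : ∀ c → All (double∷ I) (between (low c) (skip₂ b)) ≡ N * - 1ℚ + All I (down b)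
    only false = trans (left N _) (cong (N * - 1ℚ +_) (down-skip₂ b))
    only true  = trans (right N _) (cong (N * - 1ℚ +_) (down-skip₂ b))
  All-between (upp _) (low _) ()
  All-between (upp _) (upp _) ()
  All-between {I = double∷ I} (upp c) (skip₂ b) _ = begin
    two * (N * 0ℚ + N * 0ℚ + (N * 0ℚ + N * 0ℚ) + All I (λ a → when (below a b) (- - sign a)))
      ≡⟨ cong (λ u → two * (N * 0ℚ + N * 0ℚ + (N * 0ℚ + N * 0ℚ) + u)) (down-skip₂ b) ⟩
    two * (N * 0ℚ + N * 0ℚ + (N * 0ℚ + N * 0ℚ) + All I (down b))
      ≡⟨ drop N (All I (down b)) ⟩
    two * All I (down b)
      ≡⟨ All-down b ⟩
    N * (1ℚ + - sign b)
      ≡⟨ neg N (sign b) ⟩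
    - (N * (- 1ℚ + - - sign b)) ∎
    where
    open ≡-Reasoning
    drop : ∀ N s → (1ℚ + 1ℚ) * (N * 0ℚ + N * 0ℚ + (N * 0ℚ + N * 0ℚ) + s) ≡ (1ℚ + 1ℚ) * s
    drop = solve-∀ ℚ-ring
    neg : ∀ N s → N * (1ℚ + - s) ≡ - (N * (- 1ℚ + - - s))
    neg = solve-∀ ℚ-ring
  All-between (skip₂ _) (low _) ()
  All-between (skip₂ _) (upp _) ()
  All-between {I = double∷ I} (skip₂ a) (skip₂ b) l = begin
    two * (N * 0ℚ + N * 0ℚ + (N * 0ℚ + N * 0ℚ)
           + All I (λ c → when (below a c ∧ below c b) (- - sign c)))
      ≡⟨ cong (λ u → two * (N * 0ℚ + N * 0ℚ + (N * 0ℚ + N * 0ℚ) + u))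
           (All-cong I (λ c → when-neg² (below a c ∧ below c b) (sign c))) ⟩
    two * (N * 0ℚ + N * 0ℚ + (N * 0ℚ + N * 0ℚ) + All I (between a b))
      ≡⟨ drop N (All I (between a b)) ⟩
    two * All I (between a b)
      ≡⟨ All-between a b l ⟩
    - (N * (sign a + sign b))
      ≡⟨ neg² N (sign a) (sign b) ⟩
    - (N * (- - sign a + - - sign b)) ∎
    where
    open ≡-Reasoning
    drop : ∀ N s → (1ℚ + 1ℚ) * (N * 0ℚ + N * 0ℚ + (N * 0ℚ + N * 0ℚ) + s) ≡ (1ℚ + 1ℚ) * s
    drop = solve-∀ ℚ-ring
    neg² : ∀ N a b → - (N * (a + b)) ≡ - (N * (- - a + - - b))
    neg² = solve-∀ ℚ-ring

  -- Ranks are heights here, one less than in the poset obtained by adding a bottom element.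
  chainsFrom : (I : Word n) → Elt I → List ℕ → ℚ
  chainsFrom I a []       = 1ℚ
  chainsFrom I a (r ∷ rs) = All I (λ b → when (below a b ∧ (height b ≡ᵇ r)) (chainsFrom I b rs))

  chainsIn : (I : Word n) → List ℕ → ℚ
  chainsIn I []       = 1ℚ
  chainsIn I (r ∷ rs) = All I (λ b → when (height b ≡ᵇ r) (chainsFrom I b rs))

  private
    drop₁ : ∀ N s → N * 0ℚ + s ≡ s
    drop₁ = solve-∀ ℚ-ring
    drop₂ : ∀ N s → N * 0ℚ + N * 0ℚ + (N * 0ℚ + N * 0ℚ) + s ≡ s
    drop₂ = solve-∀ ℚ-ring

  chains-skip : (a : Elt I) (rs : List ℕ) →
    chainsFrom (single∷ I) (skip a) (map suc rs) ≡ chainsFrom I a rs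
  chains-skip a []       = refl
  chains-skip {I = I} a (r ∷ rs) = trans (drop₁ N _)
    (All-cong I (λ b → cong (when (below a b ∧ (height b ≡ᵇ r))) (chains-skip b rs)))

  chains-here : (I : Word n) (rs : List ℕ) →
    chainsFrom (single∷ I) here (map suc rs) ≡ chainsIn I rs
  chains-here I []       = refl
  chains-here I (r ∷ rs) = trans (drop₁ N _)
    (All-cong I (λ b → cong (when (height b ≡ᵇ r)) (chains-skip b rs)))

  chainsIn-single : (I : Word n) (rs : List ℕ) → chainsIn (single∷ I) (map suc rs) ≡ chainsIn I rs
  chainsIn-single I []       = refl
  chainsIn-single I (r ∷ rs) = trans (drop₁ N _)
    (All-cong I (λ b → cong (when (height b ≡ᵇ r)) (chains-skip b rs)))

  chains-skip₂ : (a : Elt I) (rs : List ℕ) →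
    chainsFrom (double∷ I) (skip₂ a) (map suc (map suc rs)) ≡ chainsFrom I a rs
  chains-skip₂ a []       = refl
  chains-skip₂ {I = I} a (r ∷ rs) = trans (drop₂ N _)
    (All-cong I (λ b → cong (when (below a b ∧ (height b ≡ᵇ r))) (chains-skip₂ b rs)))

  chainsIn-double : (I : Word n) (rs : List ℕ) →
    chainsIn (double∷ I) (map suc (map suc rs)) ≡ chainsIn I rs
  chainsIn-double I []       = refl
  chainsIn-double I (r ∷ rs) = trans (drop₂ N _)
    (All-cong I (λ b → cong (when (height b ≡ᵇ r)) (chains-skip₂ b rs)))

  chains-upp : (I : Word n) (c : Bool) (rs : List ℕ) →
    chainsFrom (double∷ I) (upp c) (map suc (map suc rs)) ≡ chainsIn I rs
  chains-upp I c []       = refl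
  chains-upp I c (r ∷ rs) = trans (drop₂ N _)
    (All-cong I (λ b → cong (when (height b ≡ᵇ r)) (chains-skip₂ b rs)))

  chains-low : (I : Word n) (c : Bool) (rs : List ℕ) →
    chainsFrom (double∷ I) (low c) (map suc (map suc rs)) ≡ chainsIn I rs
  chains-low I c     []       = refl
  chains-low I false (r ∷ rs) = trans (drop₂ N _)
    (All-cong I (λ b → cong (when (height b ≡ᵇ r)) (chains-skip₂ b rs)))
  chains-low I true  (r ∷ rs) = trans (drop₂ N _)
    (All-cong I (λ b → cong (when (height b ≡ᵇ r)) (chains-skip₂ b rs)))

  ranksFrom-suc : ∀ {n} o (T : Subset n) → ranksFrom (suc o) T ≡ map suc (ranksFrom o T)
  ranksFrom-suc o []          = refl
  ranksFrom-suc o (true ∷ T)  = cong (suc o ∷_) (ranksFrom-suc (suc o) T)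
  ranksFrom-suc o (false ∷ T) = ranksFrom-suc (suc o) T

  ranksFrom-2 : ∀ {n} (T : Subset n) → ranksFrom 2 T ≡ map suc (map suc (ranksFrom 0 T))
  ranksFrom-2 T = trans (ranksFrom-suc 1 T) (cong (map suc) (ranksFrom-suc 0 T))

  low-upp : (I : Word n) (c : Bool) (rs : List ℕ) →
    chainsFrom (double∷ I) (low c) (1 ∷ map suc (map suc rs)) ≡ N * chainsIn I rs
  low-upp I false rs = trans
    (cong₂ (λ u v → N * 0ℚ + N * 0ℚ + (N * u + N * 0ℚ) + v)
      (chains-upp I false rs) (All-zero I (λ _ → refl))) (one N (chainsIn I rs))
    where
    one : ∀ N u → N * 0ℚ + N * 0ℚ + (N * u + N * 0ℚ) + 0ℚ ≡ N * u
    one = solve-∀ ℚ-ring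
  low-upp I true rs = trans
    (cong₂ (λ u v → N * 0ℚ + N * 0ℚ + (N * 0ℚ + N * u) + v)
      (chains-upp I true rs) (All-zero I (λ _ → refl))) (one N (chainsIn I rs))
    where
    one : ∀ N u → N * 0ℚ + N * 0ℚ + (N * 0ℚ + N * u) + 0ℚ ≡ N * u
    one = solve-∀ ℚ-ring

  private
    lows : ∀ N u → N * u + N * u + (N * 0ℚ + N * 0ℚ) + 0ℚ ≡ (N + N) * u
    lows = solve-∀ ℚ-ring
    upps : ∀ N u → N * 0ℚ + N * 0ℚ + (N * u + N * u) + 0ℚ ≡ (N + N) * u
    upps = solve-∀ ℚ-ring

  -- Every element of a block lies below all later blocks, so whichever one a chain leaves the block
  -- from, the number of continuations is the same; hence the product over blocks.
  chainsIn-weight : (I : Word n) (T : Subset n) → chainsIn I (ranksFrom 0 T) ≡ weight N I T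
  chainsIn-weight [] [] = refl
  chainsIn-weight (single∷ I) (false ∷ T) = trans
    (cong (chainsIn (single∷ I)) (ranksFrom-suc 0 T))
    (trans (chainsIn-single I (ranksFrom 0 T)) (chainsIn-weight I T))
  chainsIn-weight (single∷ I) (true ∷ T) = trans
    (cong (chainsIn (single∷ I) ∘ (0 ∷_)) (ranksFrom-suc 0 T))
    (trans (cong₂ (λ u v → N * u + v)
        (trans (chains-here I (ranksFrom 0 T)) (chainsIn-weight I T)) (All-zero I (λ _ → refl)))
      (+-identityʳ _))
  chainsIn-weight (double∷ I) (false ∷ false ∷ T) = trans
    (cong (chainsIn (double∷ I)) (ranksFrom-2 T))
    (trans (chainsIn-double I (ranksFrom 0 T)) (chainsIn-weight I T))
  chainsIn-weight (double∷ I) (false ∷ true ∷ T) = trans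
    (cong (chainsIn (double∷ I) ∘ (1 ∷_)) (ranksFrom-2 T))
    (trans (add₅ refl refl
        (trans (chains-upp I false (ranksFrom 0 T)) (chainsIn-weight I T))
        (trans (chains-upp I true (ranksFrom 0 T)) (chainsIn-weight I T))
        (All-zero I (λ _ → refl)))
      (upps N (weight N I T)))
  chainsIn-weight (double∷ I) (true ∷ false ∷ T) = trans
    (cong (chainsIn (double∷ I) ∘ (0 ∷_)) (ranksFrom-2 T))
    (trans (add₅
        (trans (chains-low I false (ranksFrom 0 T)) (chainsIn-weight I T))
        (trans (chains-low I true (ranksFrom 0 T)) (chainsIn-weight I T))
        refl refl (All-zero I (λ _ → refl)))
      (lows N (weight N I T)))
  chainsIn-weight (double∷ I) (true ∷ true ∷ T) = trans
    (cong (λ rs → chainsIn (double∷ I) (0 ∷ 1 ∷ rs)) (ranksFrom-2 T))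
    (trans (add₅
        (trans (low-upp I false (ranksFrom 0 T)) (cong (N *_) (chainsIn-weight I T)))
        (trans (low-upp I true (ranksFrom 0 T)) (cong (N *_) (chainsIn-weight I T)))
        refl refl (All-zero I (λ _ → refl)))
      (lows N (N * weight N I T)))

-- Realising words as graded posets, with antichains of 2k elements

module WordPoset (t : ℕ) where
  private
    N : ℚ
    N = fromℕℚ (suc t)

  open Weighted N using (chainsFrom; chainsIn; chainsIn-weight; two; All-between; sign; ranksFrom-suc)
    renaming (All to Total)

  copies : A → List A
  copies = replicate (suc t)

  core : ∀ {n} (I : Word n) → List (Elt I)
  core []          = []
  core (single∷ I) = copies here ++ map skip (core I)
  core (double∷ I) = copies (low false) ++ copies (low true) ++ copies (upp false) ++
                     copies (upp true) ++ map skip₂ (core I)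

  core-sum : ∀ {n} (I : Word n) (g : Elt I → ℚ) → Sum (core I) g + g (topElt I) ≡ Total I g
  core-sum []          g = +-identityˡ _
  core-sum (single∷ I) g = trans
    (cong (_+ g (skip (topElt I))) (trans (Sum-++ (copies here) (map skip (core I)) g)
      (cong₂ _+_ (Sum-replicate (suc t) here g) (Sum-map (core I) skip g))))
    (trans (+-assoc (N * g here) (Sum (core I) (g ∘ skip)) (g (skip (topElt I))))
      (cong (N * g here +_) (core-sum I (g ∘ skip))))
  core-sum (double∷ I) g = trans
    (cong (_+ g (skip₂ (topElt I)))
      (trans (Sum-++ (copies (low false)) _ g) (cong₂ _+_ (Sum-replicate (suc t) (low false) g)
        (trans (Sum-++ (copies (low true)) _ g) (cong₂ _+_ (Sum-replicate (suc t) (low true) g)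
          (trans (Sum-++ (copies (upp false)) _ g) (cong₂ _+_ (Sum-replicate (suc t) (upp false) g)
            (trans (Sum-++ (copies (upp true)) _ g) (cong₂ _+_ (Sum-replicate (suc t) (upp true) g)
              (Sum-map (core I) skip₂ g))))))))))
    (trans (regroup (N * g (low false)) (N * g (low true)) (N * g (upp false)) (N * g (upp true))
             (Sum (core I) (g ∘ skip₂)) (g (skip₂ (topElt I))))
      (cong (N * g (low false) + N * g (low true) + (N * g (upp false) + N * g (upp true)) +_)
        (core-sum I (g ∘ skip₂))))
    where
    regroup : ∀ a b c d e f → (a + (b + (c + (d + e)))) + f ≡ (a + b + (c + d)) + (e + f)
    regroup = solve-∀ ℚ-ring

  core-top : ∀ {n} (I : Word n) → All.All (λ a → below a (topElt I) ≡ true) (core I)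
  core-top []          = All.[]
  core-top (single∷ I) = All.++⁺ (All.replicate⁺ (suc t) refl) (All.map⁺ (core-top I))
  core-top (double∷ I) = All.++⁺ (All.replicate⁺ (suc t) refl) (All.++⁺ (All.replicate⁺ (suc t) refl)
    (All.++⁺ (All.replicate⁺ (suc t) refl) (All.++⁺ (All.replicate⁺ (suc t) refl)
      (All.map⁺ (core-top I)))))

  core-complete : ∀ {n} (I : Word n) (a : Elt I) → a ≡ topElt I ⊎ a List.∈ core I
  core-complete []          peak     = inj₁ refl
  core-complete (single∷ I) here     = inj₂ (here refl)
  core-complete (single∷ I) (skip a) with core-complete I a
  ... | inj₁ e = inj₁ (cong skip e)
  ... | inj₂ i = inj₂ (∈-++⁺ʳ (copies here) (∈-map⁺ skip i))
  core-complete (double∷ I) (low false) = inj₂ (here refl)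
  core-complete (double∷ I) (low true)  = inj₂ (∈-++⁺ʳ (copies (low false)) (here refl))
  core-complete (double∷ I) (upp false) =
    inj₂ (∈-++⁺ʳ (copies (low false)) (∈-++⁺ʳ (copies (low true)) (here refl)))
  core-complete (double∷ I) (upp true) =
    inj₂ (∈-++⁺ʳ (copies (low false)) (∈-++⁺ʳ (copies (low true))
      (∈-++⁺ʳ (copies (upp false)) (here refl))))
  core-complete (double∷ I) (skip₂ a) with core-complete I a
  ... | inj₁ e = inj₁ (cong skip₂ e)
  ... | inj₂ i = inj₂ (∈-++⁺ʳ (copies (low false)) (∈-++⁺ʳ (copies (low true))
      (∈-++⁺ʳ (copies (upp false)) (∈-++⁺ʳ (copies (upp true)) (∈-map⁺ skip₂ i)))))

  module _ {n : ℕ} (I : Word n) where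

    -- The bottom element is the element `here` of an additional block of height
    -- one, listed with multiplicity one.
    elements : List (Elt (single∷ I))
    elements = skip (topElt I) ∷ here ∷ map skip (core I)

    private
      E : Set
      E = Fin (length elements)

      at : E → Elt (single∷ I)
      at = lookup elements

      position : (a : Elt (single∷ I)) → ∃[ x ] at x ≡ a
      position a = let i = listed a in index i , sym (lookup-index i)
        where
        listed : ∀ a → a List.∈ elements
        listed here     = there (here refl)
        listed (skip a) with core-complete I a
        ... | inj₁ refl = here refl
        ... | inj₂ i    = there (there (∈-map⁺ skip i))

      -- Equality is tested on positions rather than on the listed elements, so that the copies of
      -- one element form an antichain.
      le : E → E → Bool
      le x y = ⌊ x ≟ y ⌋ ∨ below (at x) (at y)

      le-below : ∀ x y → below (at x) (at y) ≡ true → le x y ≡ true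
      le-below x y h with ⌊ x ≟ y ⌋
      ... | true  = refl
      ... | false = h

      le-cases : ∀ x y → le x y ≡ true → x ≡ y ⊎ below (at x) (at y) ≡ true
      le-cases x y h with x ≟ y
      ... | yes e = inj₁ e
      ... | no _  = inj₂ h

      le-refl : ∀ x → le x x ≡ true
      le-refl x rewrite ≟-refl x x refl = refl

      le-trans : ∀ x y z → le x y ≡ true → le y z ≡ true → le x z ≡ true
      le-trans x y z p r with le-cases x y p | le-cases y z r
      ... | inj₁ refl | _         = r
      ... | inj₂ _    | inj₁ refl = p
      ... | inj₂ l    | inj₂ l′   = le-below x z (below-trans (at x) (at y) (at z) l l′)

      le-antisym : ∀ x y → le x y ≡ true → le y x ≡ true → x ≡ y
      le-antisym x y p r with le-cases x y p | le-cases y x r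
      ... | inj₁ e | _       = e
      ... | inj₂ _ | inj₁ e  = sym e
      ... | inj₂ l | inj₂ l′ = ⊥-elim (true≢false
              (below-trans (at x) (at y) (at x) l l′) (below-irrefl (at x)))

      strict : ∀ x y → (le x y ∧ not ⌊ x ≟ y ⌋) ≡ below (at x) (at y)
      strict x y with x ≟ y
      ... | yes refl = sym (below-irrefl (at x))
      ... | no _     = ∧-right (below (at x) (at y))
        where
        ∧-right : ∀ b → b ∧ true ≡ b
        ∧-right true  = refl
        ∧-right false = refl

      bottom-least : ∀ x → le (suc zero) x ≡ true
      bottom-least zero          = le-below (suc zero) zero refl
      bottom-least (suc zero)    = refl
      bottom-least (suc (suc i)) = le-below (suc zero) (suc (suc i))
        (All.lookup {P = λ b → below here b ≡ true}
          (All.map⁺ (All.universal (λ _ → refl) (core I))) (∈-lookup i))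

      top-greatest : ∀ x → le x zero ≡ true
      top-greatest zero          = refl
      top-greatest (suc zero)    = refl
      top-greatest (suc (suc i)) = le-below (suc (suc i)) zero
        (All.lookup {P = λ b → below b (topElt (single∷ I)) ≡ true}
          (All.map⁺ (core-top I)) (∈-lookup i))

      cover : ∀ x y → (le x y ∧ not ⌊ x ≟ y ⌋) ≡ true →
        (∀ z → (le x z ∧ not ⌊ x ≟ z ⌋ ∧ le z y ∧ not ⌊ z ≟ y ⌋) ≡ false) →
        height (at y) ≡ suc (height (at x))
      cover x y xy none with cover-or-between (at x) (at y) (trans (sym (strict x y)) xy)
      ... | inj₁ h = h
      ... | inj₂ (c , l , l′) with position c
      ...   | z , refl = ⊥-elim (true≢false
                (∧-assoc-true {le x z} (trans (strict x z) l) (trans (strict z y) l′)) (none z))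
        where
        ∧-assoc-true : ∀ {a b c} → a ∧ b ≡ true → c ≡ true → a ∧ b ∧ c ≡ true
        ∧-assoc-true {true} {true} _ e = e

    wordPoset : GradedPoset
    wordPoset = record
      { size        = length elements
      ; leq         = le
      ; leq-refl    = le-refl
      ; leq-antisym = le-antisym
      ; leq-trans   = le-trans
      ; bot         = suc zero
      ; top         = zero
      ; bot-min     = bottom-least
      ; top-max     = top-greatest
      ; rank        = height ∘ at
      ; rank-bot    = refl
      ; rank-cover  = cover
      }

    rank-wordPoset : rankP wordPoset ≡ suc n
    rank-wordPoset = cong suc (height-top I)

    open Poset wordPoset using (ε; module Möbius)
    open Chains wordPoset

    private
      els : List E
      els = allFin (length elements)

      sum-elements : ∀ (g : Elt (single∷ I) → ℚ) → Sum els (g ∘ at) ≡ g here + Total I (g ∘ skip)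
      sum-elements g = trans (Sum-lookup elements g)
        (trans (cong (λ u → g (skip (topElt I)) + (g here + u)) (Sum-map (core I) skip g))
          (trans (regroup (g (skip (topElt I))) (g here) (Sum (core I) (g ∘ skip)))
            (cong (g here +_) (core-sum I (g ∘ skip)))))
        where
        regroup : ∀ a b c → a + (b + c) ≡ b + (c + a)
        regroup = solve-∀ ℚ-ring

    -- `All-between` for the word with the additional block. That block is counted N times there and
    -- once here, but the bottom is never strictly between two elements, so both counts give 0.
    euler : Möbius.Euler t
    euler x y xy = trans (Sum-cong els same) (trans (sum-elements middle)
      (halve (kval t) (ε x + ε y) (middle here + Total I (middle ∘ skip)) (trans (between-here (at x) (at y)
          (trans (sym (strict x y)) xy))
        (cong (λ u → - (u * (ε x + ε y))) (sym (2kval t))))))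
      where
      middle : Elt (single∷ I) → ℚ
      middle e = when (below (at x) e ∧ below e (at y)) (sign e)
      same : ∀ z → when (lt wordPoset x z ∧ lt wordPoset z y) (ε z) ≡
                   when (below (at x) (at z) ∧ below (at z) (at y)) (sign (at z))
      same z = cong₂ (λ b b′ → when (b ∧ b′) (ε z)) (strict x z) (strict z y)
      between-here : ∀ a b → below a b ≡ true →
        two * (when (below a here ∧ below here b) 1ℚ +
               Total I (λ c → when (below a (skip c) ∧ below (skip c) b) (- sign c)))
        ≡ - (N * (sign a + sign b))
      between-here a b l = trans (cong (λ u → two * (u + Total I (λ c → when (below a (skip c) ∧ below (skip c) b) (- sign c)))) (absent a)) (All-between a b l)
        where
        zero* : ∀ N → 0ℚ ≡ N * 0ℚ
        zero* = solve-∀ ℚ-ring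
        absent : ∀ a → when (below a here ∧ below here b) 1ℚ ≡
                       N * when (below a here ∧ below here b) 1ℚ
        absent here     = zero* N
        absent (skip a) = zero* N
      halve : ∀ k c s → two * s ≡ - ((k + k) * c) → s ≡ - (k * c)
      halve k c s e = trans (half s) (trans (cong (½ *_) e) (half′ k c))
        where
        half : ∀ s → s ≡ ½ * ((1ℚ + 1ℚ) * s)
        half = solve-∀ ℚ-ring
        half′ : ∀ k c → ½ * - ((k + k) * c) ≡ - (k * c)
        half′ = solve-∀ ℚ-ring

    private
      chainsAt : Elt (single∷ I) → List ℕ → ℚ
      chainsAt here     rs = chainsIn I rs
      chainsAt (skip a) rs = chainsFrom I a rs

      chainsAt-∷ : ∀ a r rs →
        when (below a here ∧ (0 ≡ᵇ suc r)) (chainsAt here rs) +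
        Total I (λ b → when (below a (skip b) ∧ (height b ≡ᵇ r)) (chainsFrom I b rs))
        ≡ chainsAt a (r ∷ rs)
      chainsAt-∷ here     r rs = +-identityˡ _
      chainsAt-∷ (skip a) r rs = +-identityˡ _

      chainsAt-[] : ∀ a → 1ℚ ≡ chainsAt a []
      chainsAt-[] here     = refl
      chainsAt-[] (skip a) = refl

      chains-word : ∀ rs x → chains x (map suc rs) ≡ chainsAt (at x) rs
      chains-word []       x = chainsAt-[] (at x)
      chains-word (r ∷ rs) x = trans (chains-∷ x (suc r) (map suc rs))
        (trans (Sum-cong els (λ y → cong₂ (λ b u → when (b ∧ (height (at y) ≡ᵇ suc r)) u)
                                      (strict x y) (chains-word rs y)))
          (trans (sum-elements (λ b → when (below (at x) b ∧ (height b ≡ᵇ suc r)) (chainsAt b rs)))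
            (chainsAt-∷ (at x) r rs)))

    flagVec-wordPoset : ∀ S → flagVec wordPoset n S ≡ weight N I S
    flagVec-wordPoset S = trans (cong (chains (suc zero)) (ranksFrom-suc 0 S))
      (trans (chains-word (ranksFrom 0 S) (suc zero)) (chainsIn-weight I S))

-- Completeness of the relations

module Relations {X : Set} {V : (X → ℚ) → Set} (V-sub : IsSubspace V) (t : ℕ) where
  open IsSubspace V-sub
  private
    k q : ℚ
    k = kval t
    q = negInv2k t
  open Systems V-sub k q (negInv2k*2kval t)
  open Transform V-sub k q (negInv2k*2kval t)

  value-eq1 : ∀ {n} (S : Subset n) i m (f : Family n) x →
    value 1ℚ S i (suc m) f x ≡ eq1 t S (suc i) (i +ℕ suc m) (λ T → f T x)
  value-eq1 S i m f x = cong₂ _+_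
    (cong₂ (λ u v → k * (u + - v) * f S x) (sgn-1 i) (sgn-1 (i +ℕ suc m)))
    (begin
      alt (sgn 1ℚ i) (suc m) (λ j → f (insS S (suc i +ℕ j)) x)
        ≡⟨ cong (λ u → alt u (suc m) (λ j → f (insS S (suc i +ℕ j)) x)) (sgn-1 i) ⟩
      alt (neg1^ i) (suc m) (λ j → f (insS S (suc i +ℕ j)) x)
        ≡⟨ alt-neg1^ i (suc m) (λ j → f (insS S (suc i +ℕ j)) x) ⟩
      sumℚ (applyUpTo (term ∘ (suc i +ℕ_)) (suc m))
        ≡⟨ cong sumℚ (sym (map-applyUpTo (suc i +ℕ_) term (suc m))) ⟩
      sumℚ (map term (applyUpTo (suc i +ℕ_) (suc m)))
        ≡⟨ cong (sumℚ ∘ map term) (sym (map-upTo (suc i +ℕ_) (suc m))) ⟩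
      sumℚ (map term (map (suc i +ℕ_) (upTo (suc m))))
        ≡⟨ cong (λ l → sumℚ (map term (map (suc i +ℕ_) (upTo l)))) (sym (ℕ.m+n∸m≡n i (suc m))) ⟩
      sumℚ (map term (range (suc i) (i +ℕ suc m))) ∎)
    where
    open ≡-Reasoning
    term : ℕ → ℚ
    term j = neg1^ j * f (insS S j) x

  Eqs⇒eq1 : ∀ {n} {f : Family n} → Eqs 1ℚ 1ℚ n f (λ _ _ → 0ℚ) →
    ∀ S i ℓ → MaxRun false S i ℓ → V (λ x → eq1 t S i ℓ (λ T → f T x))
  Eqs⇒eq1 {f = f} e S i ℓ M = maxRun⇒run {S = S} M (λ i ℓ → V (λ x → eq1 t S i ℓ (λ T → f T x)))
    (λ i m R → resp (value-eq1 S i m f) (Eqs⇒run e (λ _ → refl , λ _ _ → refl) R))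

  eq1⇒Eqs : ∀ {n} {f : Family n} → (∀ e → V (λ x → applyEq1 t e (λ T → f T x))) →
    Eqs 1ℚ 1ℚ n f (λ _ _ → 0ℚ)
  eq1⇒Eqs {n} {f} h = runs⇒Eqs n
    (λ {S} {m} L → resp (λ x → cong (k * (1ℚ + - sgn 1ℚ m) * f S x +_) (sym (+-identityˡ _)))
      (run (here L)))
    (λ R → run (weaken R))
    where
    run : ∀ {S i m} → Run false true S i m → V (value 1ℚ S i m f)
    run {S} {i} {zero}  R = empty-run 1ℚ S i f
    run {S} {i} {suc m} R = resp (λ x → sym (value-eq1 S i m f x))
      (h (eqIx S (suc i) (i +ℕ suc m) (run⇒maxRun R)))

  mutual
    EvenNull-zero : ∀ n → EvenNull n (λ _ _ → 0ℚ)
    EvenNull-zero zero    = tt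
    EvenNull-zero (suc n) = EvenNull-zero n , OddNull-lin n 0ℚ 0ℚ
      (λ T → resp (λ x → zeros q) zero∈) (OddNull-zero n) (OddNull-zero n)
      where
      zeros : ∀ q → 0ℚ ≡ (0ℚ + q * 0ℚ) + - (0ℚ * 0ℚ + 0ℚ * 0ℚ)
      zeros = solve-∀ ℚ-ring

    OddNull-zero : ∀ n → OddNull n (λ _ _ → 0ℚ)
    OddNull-zero zero    = zero∈
    OddNull-zero (suc n) = (λ _ → zero∈) , EvenNull-zero n

  private
    live-1 : ∀ q k f → 0ℚ ≡
      f + - (1ℚ * (- q * 1ℚ * (k * (1ℚ + - 1ℚ) * f + 0ℚ) + 1ℚ * 1ℚ * f)
             + 0ℚ * (- q * 1ℚ * (k * (1ℚ + - 1ℚ) * f + 0ℚ) + 1ℚ * 1ℚ * f))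
    live-1 = solve-∀ ℚ-ring
    1-live : ∀ q k f → 0ℚ ≡
      (- q * 1ℚ * (k * (1ℚ + - 1ℚ) * f + 0ℚ) + 1ℚ * 1ℚ * f) + - (1ℚ * f + 0ℚ * f)
    1-live = solve-∀ ℚ-ring
    1-dead : ∀ q k f → 0ℚ ≡
      - q * 1ℚ * (k * (1ℚ + - 1ℚ) * f + 0ℚ) + - (1ℚ * 0ℚ + 0ℚ * 0ℚ)
    1-dead = solve-∀ ℚ-ring

  -- Before anything is read, σ = τ = 1 and s = 0, so `live` is f and `dead` is zero.
  Eqs⇒EvenNull : ∀ n {f : Family n} → Eqs 1ℚ 1ℚ n f (λ _ _ → 0ℚ) → EvenNull n f
  Eqs⇒EvenNull n {f} e = EvenNull-lin n 1ℚ 0ℚ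
    (λ T → resp (λ x → live-1 q k (f T x)) zero∈) (proj₁ null) (proj₁ null)
    where null = Eqs⇒Null n refl refl e

  EvenNull⇒Eqs : ∀ n {f : Family n} → EvenNull n f → Eqs 1ℚ 1ℚ n f (λ _ _ → 0ℚ)
  EvenNull⇒Eqs n {f} e = Null⇒Eqs n refl refl
    (EvenNull-lin n 1ℚ 0ℚ (λ T → resp (λ x → 1-live q k (f T x)) zero∈) e e)
    (OddNull-lin n 1ℚ 0ℚ (λ T → resp (λ x → 1-dead q k (f T x)) zero∈)
      (OddNull-zero n) (OddNull-zero n))

  private
    when-merge : ∀ b p q u v →
      1ℚ * when b (p * u) + 1ℚ * when b (q * p * v) ≡ when b (p * (u + q * v))
    when-merge true  = dist
      where
      dist : ∀ p q u v → 1ℚ * (p * u) + 1ℚ * (q * p * v) ≡ p * (u + q * v)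
      dist = solve-∀ ℚ-ring
    when-merge false p q u v = refl

    when-scale : ∀ b p q v → 1ℚ * 0ℚ + 1ℚ * when b (q * p * v) ≡ q * when b (p * v) + 0ℚ * 0ℚ
    when-scale true  = assoc
      where
      assoc : ∀ p q v → 1ℚ * 0ℚ + 1ℚ * (q * p * v) ≡ q * (p * v) + 0ℚ * 0ℚ
      assoc = solve-∀ ℚ-ring
    when-scale false p q v = zeros q
      where
      zeros : ∀ q → 0ℚ ≡ q * 0ℚ + 0ℚ * 0ℚ
      zeros = solve-∀ ℚ-ring

    plus-zero : ∀ a b → a + 0ℚ * b ≡ a
    plus-zero = solve-∀ ℚ-ring

  transform-sum : ∀ {n} (S : Subset n) (f : Family n) x →
    ΣS n (λ T → when (supCompl S T) (powℚ q ∣ T ∣ * f T x)) ≡ transform S f x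
  transform-sum []          f x = *-identityˡ (f [] x)
  transform-sum {suc n} (true ∷ S) f x = trans (sym (ΣS-sum n _ _))
    (trans (ΣS-cong n (λ T → when-merge (supCompl S T) (powℚ q ∣ T ∣) q
                               (f (false ∷ T) x) (f (true ∷ T) x)))
      (transform-sum S (merge f) x))
  transform-sum {suc n} (false ∷ S) f x = trans (sym (ΣS-sum n _ _))
    (trans (ΣS-cong n (λ T → when-scale (supCompl S T) (powℚ q ∣ T ∣) q (f (true ∷ T) x)))
      (trans (ΣS-lin n q 0ℚ _ (λ _ → 0ℚ))
        (trans (plus-zero _ (ΣS n (λ _ → 0ℚ)))
          (cong (q *_) (transform-sum S (f ∘ (true ∷_)) x)))))

-- The three claims, from numbers and from functionals modulo the relations

module _ (t n : ℕ) where
  open Relations ℚ-zero t using (Eqs⇒eq1; eq1⇒Eqs; Eqs⇒EvenNull; EvenNull⇒Eqs; transform-sum)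
  open Transform ℚ-zero (kval t) (negInv2k t) (negInv2k*2kval t)
    using (EvenNull⇒transform; transform⇒EvenNull; transform)

  eq1-holds : (P : GradedPoset) → rankP P ≡ suc n → KEulerian t P →
    (S : Subset n) (i ℓ : ℕ) → MaxRun false S i ℓ → eq1 t S i ℓ (flagVec P n) ≡ 0ℚ
  eq1-holds P r eul = Eqs⇒eq1 (Flags.flagVec-Eqs P t (Poset.Möbius.KEulerian⇒Euler P t eul) n r)

  Lk-transform : (S : Subset n) (f : Subset n → ℚ) →
    Lk t n S f ≡ neg1^ (n ∸ ∣ S ∣) * transform S (λ T _ → f T) tt
  Lk-transform S f = cong (neg1^ (n ∸ ∣ S ∣) *_)
    (trans (Sum-allSubsets n _) (transform-sum S (λ T _ → f T) tt))

  eq1⇔Lk : (f : Subset n → ℚ) →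
    ((e : Eq1Index n) → applyEq1 t e f ≡ 0ℚ) ⇔ ((S : Subset n) → ¬ IsEven S → Lk t n S f ≡ 0ℚ)
  eq1⇔Lk f = mk⇔
    (λ h S odd → trans (Lk-transform S f) (trans
      (cong (neg1^ (n ∸ ∣ S ∣) *_)
        (EvenNull⇒transform (Eqs⇒EvenNull n (eq1⇒Eqs {f = λ T _ → f T} h)) S
          (not-true (λ e → ⊥-elim (odd (even⇒IsEven S e))))))
      (*-zeroʳ (neg1^ (n ∸ ∣ S ∣)))))
    (λ h → λ where
      (eqIx S i ℓ M) → Eqs⇒eq1 {f = λ T _ → f T} (EvenNull⇒Eqs n (transform⇒EvenNull n (λ S e →
        unsign (n ∸ ∣ S ∣) (trans (sym (Lk-transform S f))
          (h S (λ ev → true≢false (IsEven⇒even S ev) e)))))) S i ℓ M)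
    where
    unsign : ∀ m {a} → neg1^ m * a ≡ 0ℚ → a ≡ 0ℚ
    unsign m {a} e = begin
      a                        ≡⟨ sym (*-identityˡ a) ⟩
      1ℚ * a                   ≡⟨ cong (_* a) (sym (neg1^-square m)) ⟩
      neg1^ m * neg1^ m * a    ≡⟨ *-assoc (neg1^ m) (neg1^ m) a ⟩
      neg1^ m * (neg1^ m * a)  ≡⟨ cong (neg1^ m *_) e ⟩
      neg1^ m * 0ℚ             ≡⟨ *-zeroʳ (neg1^ m) ⟩
      0ℚ ∎
      where
      open ≡-Reasoning

  Functional : Set
  Functional = (Subset n → ℚ) → ℚ

  combination : List (ℚ × Eq1Index n) → Functional
  combination combo f = Sum combo (λ p → proj₁ p * applyEq1 t (proj₂ p) f)

  InSpan : Functional → Set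
  InSpan φ = ∃[ combo ] (∀ f → φ f ≡ combination combo f)

  InSpan-subspace : IsSubspace InSpan
  InSpan-subspace = record
    { resp  = λ { e (combo , h) → combo , λ f → trans (sym (e f)) (h f) }
    ; zero∈ = [] , λ _ → refl
    ; add   = λ { (combo , h) (combo′ , h′) → combo ++ combo′ ,
                λ f → trans (cong₂ _+_ (h f) (h′ f)) (sym (Sum-++ combo combo′ _)) }
    ; scale = λ { c (combo , h) → map (λ p → c * proj₁ p , proj₂ p) combo , λ f →
                trans (cong (c *_) (h f)) (trans (sym (Sum-scale combo c _))
                  (trans (Sum-cong combo (λ p → sym (*-assoc c (proj₁ p) (applyEq1 t (proj₂ p) f))))
                    (sym (Sum-map combo (λ p → c * proj₁ p , proj₂ p)
                            (λ p → proj₁ p * applyEq1 t (proj₂ p) f))))) }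
    }

  private module R = Relations InSpan-subspace t

  flag-relations : (c : Subset n → ℚ) →
    ((P : GradedPoset) → rankP P ≡ suc n → KEulerian t P → dot c (flagVec P n) ≡ 0ℚ) →
    InSpanEq1 t n c
  flag-relations c h = IsSubspace.resp InSpan-subspace (λ f → sym (Sum-allSubsets n (λ S → c S * f S)))
    (Transform.annihilator-V InSpan-subspace (kval t) (negInv2k t) (negInv2k*2kval t) n c
      annihilates (R.Eqs⇒EvenNull n {f = λ S f → f S} (R.eq1⇒Eqs member)))
    where
    -- A relation evaluated on the generic family is that relation itself, a one-term combination;
    -- so the generic family satisfies the whole system modulo the span.
    member : ∀ e → InSpan (applyEq1 t e)
    member e = (1ℚ , e) ∷ [] , λ f → once (applyEq1 t e f)
      where
      once : ∀ a → a ≡ 1ℚ * a + 0ℚ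
      once = solve-∀ ℚ-ring
    annihilates : ∀ I → ΣS n (λ S → c S * weight (kval t + kval t) I S) ≡ 0ℚ
    annihilates I = begin
      ΣS n (λ S → c S * weight (kval t + kval t) I S)
        ≡⟨ ΣS-cong n (λ S → cong (c S *_) (trans (cong (λ N → weight N I S) (2kval t))
             (sym (WordPoset.flagVec-wordPoset t I S)))) ⟩
      ΣS n (λ S → c S * flagVec P n S)
        ≡⟨ sym (Sum-allSubsets n _) ⟩
      dot c (flagVec P n)
        ≡⟨ h P (WordPoset.rank-wordPoset t I)
             (Poset.Möbius.Euler⇒KEulerian P t (WordPoset.euler t I)) ⟩
      0ℚ ∎
      where
      open ≡-Reasoning
      P = WordPoset.wordPoset t I

mainTheorem8 : (t n : ℕ) →
    ((P : GradedPoset) → rankP P ≡ suc n → KEulerian t P →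
    (S : Subset n) (i ℓ : ℕ) → MaxRun false S i ℓ →
    eq1 t S i ℓ (flagVec P n) ≡ 0ℚ)
    × ((c : Subset n → ℚ) →
    ((P : GradedPoset) → rankP P ≡ suc n → KEulerian t P → dot c (flagVec P n) ≡ 0ℚ) →
    InSpanEq1 t n c)
    × ((f : Subset n → ℚ) →
    ((e : Eq1Index n) → applyEq1 t e f ≡ 0ℚ)
    ⇔ ((S : Subset n) → ¬ IsEven S → Lk t n S f ≡ 0ℚ))
mainTheorem8 t n = eq1-holds t n , flag-relations t n , eq1⇔Lk t n
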